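{- Let $e\geq 2$ be an integer. Let $K$ be a finite commutative ring with identity having precisely three ideals: $\langle 0\rangle$, $J$ and $K$. Let $K/J\cong \mathbb{F}_q$, where $\mathbb{F}_q$ is a finite field of order $q$ for a prime power $q$. Then the graph $Y(2e,K)$ is a divisible design graph with parameters $(v,k,\lambda_1,\lambda_2,m,n)$ where $v=\frac{q^{2e-1}(q^{2e}-1)}{q-1}$, $k=q^{4e-3}-q^{2e-2}$, $\lambda_1=q^{4e-3}-q^{4e-4}-q^{2e-2}$, $\lambda_2=q^{4e-4}-q^{4e-5}-q^{2e-2}+q^{2e-3}$, $m=\frac{q^{2e}-1}{q-1}$, $n=q^{2e-1}$.
   Context: A divisible design graph with parameters $(v,k,\lambda_1,\lambda_2,m,n)$ is a $k$-regular graph on $v$ vertices whose vertex set can be partitioned into $m$ classes of size $n$ such that any two distinct vertices in the same class have exactly $\lambda_1$ common neighbours and any two vertices in different classes have exactly $\lambda_2$ common neighbours. Let $K^\times$ be the set of units of $K$. Let $V'$ be the set of tuples $(a_1,\ldots,a_{2e})\in K^{2e}$ having at least one entry in $K^\times$. Two tuples $a,b\in V'$ are equivalent if $a=\lambda b$ for some $\lambda\in K^\times$; write $[a]$ for the class of $a$ and let $V$ be the set of classes. For $a,b\in K^{2e}$ put $\langle a,b\rangle=\sum_{i=1}^{e}(a_ib_{e+i}-a_{e+i}b_i)$ (i.e. $aMb^t$ with $M=\begin{bmatrix}0&I_e\\-I_e&0\end{bmatrix}$). The graph $Y(2e,K)$ has vertex set $V$, with $[a]$ adjacent to $[b]$ iff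 $\langle a,b\rangle\in J\setminus\{0\}$. -}

module Defs where

open import Level using (Level; 0ℓ; _⊔_)
open import Data.Nat as ℕ using (ℕ; zero; suc; _∸_; _^_; _≤_; _/_)
open import Data.Nat.Primality using (Prime)
open import Data.Fin using (Fin; _↑ˡ_; _↑ʳ_)
open import Data.Unit using (⊤)
open import Data.Product using (Σ; ∃; _×_; _,_; proj₁)
open import Data.Sum using (_⊎_)
open import Relation.Binary.PropositionalEquality using (_≡_; _≢_)
open import Relation.Binary.Definitions using (Decidable)
open import Relation.Binary.Structures using (IsEquivalence)
open import Relation.Nullary using (¬_)
open import Algebra.Bundles using (CommutativeRing)

HasClassCount : ∀ {a ℓ p} {A : Set a} (_~_ : A → A → Set ℓ) (P : A → Set p)
              → ℕ → Set (a ⊔ ℓ ⊔ p)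
HasClassCount {A = A} _~_ P c =
  Σ (Fin c → A) λ f →
    (∀ i → P (f i)) ×
    (∀ i j → f i ~ f j → i ≡ j) ×
    (∀ x → P x → ∃ λ i → f i ~ x)

-- Divisible design graphs.  The graph has vertex set A / _~_ (a setoid),
-- adjacency Adj (respecting _~_, symmetric, loopless).

record IsDDG {a ℓ r} {A : Set a} (_~_ : A → A → Set ℓ) (Adj : A → A → Set r)
             (v k λ₁ λ₂ m n : ℕ) : Set (a ⊔ ℓ ⊔ r) where
  field
    ~-equiv     : IsEquivalence _~_
    adj-resp    : ∀ {x x′ y y′} → x ~ x′ → y ~ y′ → Adj x y → Adj x′ y′
    adj-sym     : ∀ {x y} → Adj x y → Adj y x
    adj-irrefl  : ∀ x → ¬ Adj x x
    order       : HasClassCount _~_ (λ _ → ⊤) v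
    regular     : ∀ x → HasClassCount _~_ (Adj x) k
    part        : A → Fin m
    part-resp   : ∀ {x y} → x ~ y → part x ≡ part y
    part-size   : ∀ i → HasClassCount _~_ (λ x → part x ≡ i) n
    same-class  : ∀ x y → ¬ (x ~ y) → part x ≡ part y →
                  HasClassCount _~_ (λ z → Adj x z × Adj y z) λ₁
    diff-class  : ∀ x y → part x ≢ part y →
                  HasClassCount _~_ (λ z → Adj x z × Adj y z) λ₂

IsPrimePower : ℕ → Set
IsPrimePower q = ∃ λ p → ∃ λ r → Prime p × 1 ≤ r × q ≡ p ^ r

-- natural-number division, used only with nonzero divisor (q - 1, q ≥ 2)
_div_ : ℕ → ℕ → ℕ
x div zero    = 0
x div (suc d) = x / suc d

module _ (R : CommutativeRing 0ℓ 0ℓ) where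
  open CommutativeRing R
  open import Algebra.Definitions.RawMonoid +-rawMonoid using (sum)

  IsFiniteRing : Set
  IsFiniteRing = Decidable _≈_ × ∃ λ N → HasClassCount _≈_ (λ _ → ⊤) N

  IsIdeal : (Carrier → Set) → Set
  IsIdeal I = (∀ {x y} → x ≈ y → I x → I y) × I 0#
            × (∀ {x y} → I x → I y → I (x + y))
            × (∀ r {x} → I x → I (r * x))

  SameIdeal : (Carrier → Set) → (Carrier → Set) → Set
  SameIdeal I I′ = ∀ x → (I x → I′ x) × (I′ x → I x)

  ZeroIdeal : Carrier → Set
  ZeroIdeal x = x ≈ 0#

  WholeRing : Carrier → Set
  WholeRing _ = ⊤

  HasExactlyThreeIdeals : (Carrier → Set) → Set₁
  HasExactlyThreeIdeals J =
    IsIdeal J × ¬ SameIdeal J ZeroIdeal × ¬ SameIdeal J WholeRing ×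
    (∀ I → IsIdeal I → SameIdeal I ZeroIdeal ⊎ SameIdeal I J ⊎ SameIdeal I WholeRing)

  QuotientHasSize : (Carrier → Set) → ℕ → Set
  QuotientHasSize J q = HasClassCount (λ x y → J (x - y)) (λ _ → ⊤) q

  IsUnit : Carrier → Set
  IsUnit x = ∃ λ y → x * y ≈ 1#

  Tuple : ℕ → Set
  Tuple e = Fin (e ℕ.+ e) → Carrier

  symp : (e : ℕ) → Tuple e → Tuple e → Carrier
  symp e a b = sum (λ i → a (i ↑ˡ e) * b (e ↑ʳ i) - a (e ↑ʳ i) * b (i ↑ˡ e))

  YVertex : ℕ → Set
  YVertex e = Σ (Tuple e) λ a → ∃ λ i → IsUnit (a i)

  YEquiv : (e : ℕ) → YVertex e → YVertex e → Set
  YEquiv e (a , _) (b , _) = ∃ λ l → IsUnit l × (∀ i → a i ≈ l * b i)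

  YAdj : (J : Carrier → Set) (e : ℕ) → YVertex e → YVertex e → Set
  YAdj J e (a , _) (b , _) = J (symp e a b) × ¬ (symp e a b ≈ 0#)

vY kY λ₁Y λ₂Y mY nY : ℕ → ℕ → ℕ
vY  q e = (q ^ (2 ℕ.* e ∸ 1) ℕ.* (q ^ (2 ℕ.* e) ∸ 1)) div (q ∸ 1)
kY  q e = q ^ (4 ℕ.* e ∸ 3) ∸ q ^ (2 ℕ.* e ∸ 2)
λ₁Y q e = q ^ (4 ℕ.* e ∸ 3) ∸ q ^ (4 ℕ.* e ∸ 4) ∸ q ^ (2 ℕ.* e ∸ 2)
λ₂Y q e = (q ^ (4 ℕ.* e ∸ 4) ∸ q ^ (4 ℕ.* e ∸ 5) ∸ q ^ (2 ℕ.* e ∸ 2)) ℕ.+ q ^ (2 ℕ.* e ∸ 3)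
mY  q e = (q ^ (2 ℕ.* e) ∸ 1) div (q ∸ 1)
nY  q e = q ^ (2 ℕ.* e ∸ 1)

{-# OPTIONS --safe #-}
module Submission where

-- K is local with maximal ideal J, every nonzero x ∈ J generates J, and J² = 0; multiplication by x
-- identifies K/J with J, so |J| = q and |K| = q².  Every vertex is represented by q² - q tuples, and
-- the classes of the design are the points of the projective space of K/J below the vertices.  For a
-- vertex [a], b ↦ ⟨a,b⟩ is a surjective homomorphism K^2e → K; for two vertices the image of
-- b ↦ (⟨a,b⟩, ⟨a′,b⟩) is K² if they lie in different classes, and {(s,t) : t - rs ∈ J} if a′ ≡ ra mod J.
-- All fibres of a homomorphism have the same size, so the tuples b with prescribed values in J∖0 are
-- counted by the index of the image; those with all entries in J, which represent no vertex, are
-- counted in the same way and subtracted.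

open import Defs
open import Level using (Level; 0ℓ)
open import Function using (_∘_; id)
open import Data.Nat as ℕ using (ℕ; zero; suc; _∸_; _^_; _≤_; s≤s; z≤n; NonZero)
import Data.Nat.Properties as ℕₚ
open import Data.Nat.DivMod using (m*n/n≡m)
open import Data.Nat.Tactic.RingSolver using (solve-∀)
open import Data.Fin using (Fin; zero; suc; splitAt; join; remQuot; combine; finToFun; funToFin; _↑ˡ_; _↑ʳ_)
import Data.Fin.Properties as Finₚ
open import Data.Unit using (⊤; tt)
open import Data.Empty using (⊥-elim)
open import Data.Product using (∃; _×_; _,_; proj₁; proj₂; uncurry)
open import Data.Product.Relation.Binary.Pointwise.NonDependent using (Pointwise)
open import Data.Sum using (_⊎_; inj₁; inj₂; [_,_]′)
open import Relation.Binary.PropositionalEquality as ≡ using (_≡_; _≢_; cong; cong₂; subst)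
open import Relation.Binary.Definitions using (Decidable)
open import Relation.Binary.Structures using (IsEquivalence)
open import Relation.Nullary using (¬_; Dec; yes; no; ¬?)
open import Relation.Nullary.Decidable using (map′; _×-dec_; decidable-stable)
open import Algebra.Bundles using (CommutativeRing; Group)
import Algebra.Construct.DirectProduct as DirectProduct
import Algebra.Construct.Pointwise as Pointwise
import Algebra.Properties.AbelianGroup as AbelianGroupₚ
import Algebra.Properties.CommutativeSemigroup as CommutativeSemigroupₚ
import Algebra.Properties.Group as Groupₚ
import Algebra.Properties.Ring as Ringₚ
import Algebra.Properties.Semiring.Sum as Sumₚ
import Relation.Binary.Reasoning.Setoid as SetoidReasoning

-- Counting classes

-- Kernels and quotients have no explicit enumeration here. Their sizes first appear as unknown
-- numbers, by filtering a finite list of representatives, and are then pinned by counting one set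
-- in two ways: `t * k ≡ s` for a kernel, `c * (q * q ∸ q) ≡ n` for a set of vertices. All divisions
-- are thereby postponed to the final arithmetic. What separates the two intersection numbers, apart
-- from the index of the image, is the subtracted term. Over tuples with entries in J, two vertices
-- of one class have proportional forms, because a′ - ra has entries in J and J² = 0. The second
-- condition then follows from the first, so only q - 1 pairs of values occur and q^(2e-2) is
-- subtracted. For different classes the conditions are independent, all (q - 1)² pairs occur, and
-- q^(2e-2) - q^(2e-3) is subtracted.

private
  variable
    a b ℓ ℓ′ ℓp ℓp′ ℓq : Level
    A : Set a
    B : Set b

-- Pointwise equality of functions does not give propositional equality, so injectivity in
-- `count-functions` goes through this congruence.
funToFin-cong : ∀ {m n} {f g : Fin m → Fin n} → (∀ i → f i ≡ g i) → funToFin f ≡ funToFin g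
funToFin-cong {zero}  f≗g = ≡.refl
funToFin-cong {suc m} f≗g = cong₂ combine (f≗g zero) (funToFin-cong (f≗g ∘ suc))

module _ {_~_ : A → A → Set ℓ} where

  count-cong : {P : A → Set ℓp} {Q : A → Set ℓp′} {c : ℕ} →
               (∀ x → P x → Q x) → (∀ x → Q x → P x) →
               HasClassCount _~_ P c → HasClassCount _~_ Q c
  count-cong P⇒Q Q⇒P (f , Pf , inj , sur) =
    f , (λ i → P⇒Q _ (Pf i)) , inj , (λ x Qx → sur x (Q⇒P x Qx))

  count-singleton : {P : A → Set ℓp} (x : A) → P x → (∀ y → P y → x ~ y) → HasClassCount _~_ P 1
  count-singleton x Px x~ = (λ _ → x) , (λ _ → Px) , (λ { zero zero _ → ≡.refl }) , λ y Py → zero , x~ y Py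

  count-⊎ : {P : A → Set ℓp} {Q : A → Set ℓp′} {c d : ℕ} →
            IsEquivalence _~_ → (∀ x y → P x → Q y → ¬ (x ~ y)) →
            HasClassCount _~_ P c → HasClassCount _~_ Q d →
            HasClassCount _~_ (λ x → P x ⊎ Q x) (c ℕ.+ d)
  count-⊎ {P = P} {Q = Q} {c} {d} eq disj (f , Pf , injf , surf) (g , Qg , injg , surg) =
    h ∘ splitAt c , PQh ∘ splitAt c , inj , sur
    where
    open IsEquivalence eq
    h : Fin c ⊎ Fin d → A
    h = [ f , g ]′
    PQh : ∀ s → P (h s) ⊎ Q (h s)
    PQh (inj₁ i) = inj₁ (Pf i)
    PQh (inj₂ j) = inj₂ (Qg j)
    injh : ∀ s t → h s ~ h t → s ≡ t
    injh (inj₁ i) (inj₁ j) r = cong inj₁ (injf i j r)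
    injh (inj₁ i) (inj₂ j) r = ⊥-elim (disj _ _ (Pf i) (Qg j) r)
    injh (inj₂ i) (inj₁ j) r = ⊥-elim (disj _ _ (Pf j) (Qg i) (sym r))
    injh (inj₂ i) (inj₂ j) r = cong inj₂ (injg i j r)
    inj : ∀ i j → h (splitAt c i) ~ h (splitAt c j) → i ≡ j
    inj i j r = ≡.trans (≡.sym (Finₚ.join-splitAt c d i))
                (≡.trans (cong (join c d) (injh (splitAt c i) (splitAt c j) r)) (Finₚ.join-splitAt c d j))
    sur : ∀ x → P x ⊎ Q x → ∃ λ i → h (splitAt c i) ~ x
    sur x (inj₁ Px) with i , r ← surf x Px =
      i ↑ˡ d , subst (λ s → h s ~ x) (≡.sym (Finₚ.splitAt-↑ˡ c i d)) r
    sur x (inj₂ Qx) with i , r ← surg x Qx =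
      c ↑ʳ i , subst (λ s → h s ~ x) (≡.sym (Finₚ.splitAt-↑ʳ c d i)) r

  -- Sending each representative of one count to its match in the other is injective; this is done
  -- in both directions.
  count-unique : {P : A → Set ℓp} {c d : ℕ} → IsEquivalence _~_ →
                 HasClassCount _~_ P c → HasClassCount _~_ P d → c ≡ d
  count-unique {P = P} eq C D = ℕₚ.≤-antisym (le C D) (le D C)
    where
    open IsEquivalence eq
    le : ∀ {c d} → HasClassCount _~_ P c → HasClassCount _~_ P d → c ≤ d
    le (f , Pf , injf , _) (g , _ , _ , surg) =
      Finₚ.injective⇒≤ {f = λ i → proj₁ (surg (f i) (Pf i))} λ {i} {j} r →
        injf i j (trans (sym (proj₂ (surg (f i) (Pf i))))
                 (subst (λ k → g k ~ f j) (≡.sym r) (proj₂ (surg (f j) (Pf j)))))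

  -- Greedy selection: an entry of the list is kept if it satisfies `Q` and is inequivalent to all
  -- those kept so far. The list may hit a class repeatedly, so representatives for a finer relation
  -- serve to count a coarser one.
  count-covered : {Q : A → Set ℓp} → IsEquivalence _~_ → Decidable _~_ →
                  (∀ x → Dec (Q x)) → (∀ {x y} → x ~ y → Q x → Q y) →
                  ∀ {N} (f : Fin N → A) →
                  ∃ λ c → HasClassCount _~_ (λ x → Q x × ∃ λ j → f j ~ x) c
  count-covered {Q = Q} eq _~?_ Q? Q-resp {zero} f =
    0 , (λ ()) , (λ ()) , (λ ()) , λ { x (_ , () , _) }
  count-covered {Q = Q} eq _~?_ Q? Q-resp {suc N} f
    with c , g , Qg , inj , sur ← count-covered eq _~?_ Q? Q-resp (f ∘ suc)
    with Q? (f zero) ×-dec ¬? (Finₚ.any? (λ i → g i ~? f zero))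
  ... | yes (Q₀ , new) = suc c , g′ , Qg′ , inj′ , sur′
    where
    open IsEquivalence eq
    g′ : Fin (suc c) → A
    g′ zero    = f zero
    g′ (suc i) = g i
    Qg′ : ∀ i → Q (g′ i) × ∃ λ j → f j ~ g′ i
    Qg′ zero    = Q₀ , zero , refl
    Qg′ (suc i) = proj₁ (Qg i) , suc (proj₁ (proj₂ (Qg i))) , proj₂ (proj₂ (Qg i))
    inj′ : ∀ i j → g′ i ~ g′ j → i ≡ j
    inj′ zero    zero    r = ≡.refl
    inj′ zero    (suc j) r = ⊥-elim (new (j , sym r))
    inj′ (suc i) zero    r = ⊥-elim (new (i , r))
    inj′ (suc i) (suc j) r = cong suc (inj i j r)
    sur′ : ∀ x → (Q x × ∃ λ j → f j ~ x) → ∃ λ i → g′ i ~ x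
    sur′ x (Qx , zero  , r) = zero , r
    sur′ x (Qx , suc j , r) with i , s ← sur x (Qx , j , r) = suc i , s
  ... | no ¬new = c , g , (λ i → proj₁ (Qg i) , suc (proj₁ (proj₂ (Qg i))) , proj₂ (proj₂ (Qg i)))
                , inj , sur′
    where
    open IsEquivalence eq
    sur′ : ∀ x → (Q x × ∃ λ j → f j ~ x) → ∃ λ i → g i ~ x
    sur′ x (Qx , suc j , r) = sur x (Qx , j , r)
    -- The head of the list was rejected although `Q` holds for it, so an equivalent entry has
    -- already been kept.
    sur′ x (Qx , zero  , r) with Finₚ.any? (λ i → g i ~? f zero)
    ... | yes (i , s) = i , trans s r
    ... | no  new     = ⊥-elim (¬new (Q-resp (sym r) Qx , new))

  count-filter : {P : A → Set ℓp} {Q : A → Set ℓp′} {N : ℕ} →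
                 IsEquivalence _~_ → Decidable _~_ →
                 (∀ {x y} → x ~ y → P x → P y) →
                 (∀ x → Dec (Q x)) → (∀ {x y} → x ~ y → Q x → Q y) →
                 HasClassCount _~_ P N → ∃ λ c → HasClassCount _~_ (λ x → P x × Q x) c
  count-filter eq _~?_ P-resp Q? Q-resp (f , Pf , _ , sur)
    with c , C ← count-covered eq _~?_ Q? Q-resp f =
    c , count-cong (λ { x (Qx , j , r) → P-resp r (Pf j) , Qx })
                   (λ { x (Px , Qx) → Qx , sur x Px }) C

  -- The difference is counted by an unknown `r`; reuniting it with `Q` gives `r + d ≡ c`. The
  -- truncated subtraction is therefore always exact.
  count-∖ : {P : A → Set ℓp} {Q : A → Set ℓp′} {c d : ℕ} →
            IsEquivalence _~_ → Decidable _~_ → (∀ {x y} → x ~ y → P x → P y) →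
            (∀ x → Dec (Q x)) → (∀ {x y} → x ~ y → Q x → Q y) →
            (∀ x → Q x → P x) →
            HasClassCount _~_ P c → HasClassCount _~_ Q d →
            HasClassCount _~_ (λ x → P x × ¬ Q x) (c ∸ d)
  count-∖ {P = P} {Q = Q} {c} {d} eq _~?_ P-resp Q? Q-resp Q⊆P C D
    with r , R ← count-filter eq _~?_ P-resp (¬? ∘ Q?) (λ x~y ¬Qx Qy → ¬Qx (Q-resp (IsEquivalence.sym eq x~y) Qy)) C
    = subst (HasClassCount _~_ (λ x → P x × ¬ Q x)) r≡c∸d R
    where
    U : HasClassCount _~_ P (r ℕ.+ d)
    U = count-cong (λ { x (inj₁ (Px , _)) → Px ; x (inj₂ Qx) → Q⊆P x Qx })
                   (λ x Px → case Px (Q? x))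
                   (count-⊎ eq (λ { x y (_ , ¬Qx) Qy x~y → ¬Qx (Q-resp (IsEquivalence.sym eq x~y) Qy) }) R D)
      where
      case : ∀ {x} → P x → Dec (Q x) → (P x × ¬ Q x) ⊎ Q x
      case Px (yes Qx) = inj₂ Qx
      case Px (no ¬Qx) = inj₁ (Px , ¬Qx)
    r≡c∸d : r ≡ c ∸ d
    r≡c∸d = ≡.trans (≡.sym (ℕₚ.m+n∸n≡m r d)) (cong (_∸ d) (count-unique eq U C))

  count-functions : {P : A → Set ℓp} {c : ℕ} (n : ℕ) → HasClassCount _~_ P c →
                    HasClassCount (λ (s t : Fin n → A) → ∀ i → s i ~ t i) (λ s → ∀ i → P (s i)) (c ^ n)
  count-functions {c = c} n (f , Pf , inj , sur) =
    (λ k → f ∘ finToFun k) , (λ k i → Pf _) ,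
    (λ k l r → ≡.trans (≡.sym (Finₚ.funToFin-finToFin {n} k))
               (≡.trans (funToFin-cong (λ i → inj _ _ (r i))) (Finₚ.funToFin-finToFin {n} l))) ,
    λ s Ps → funToFin (λ i → proj₁ (sur (s i) (Ps i))) ,
      λ i → subst (λ k → f k ~ s i) (≡.sym (Finₚ.finToFun-funToFin (λ j → proj₁ (sur (s j) (Ps j))) i))
                  (proj₂ (sur (s i) (Ps i)))

module _ {_≈_ : A → A → Set ℓ} {_~_ : B → B → Set ℓ′} where

  -- The map lives on `P` only, and its congruence is asked for just where it matters: everything
  -- equivalent to the chosen preimage of `y` must land in the class of `y`.
  count-map : {P : A → Set ℓp} {Q : B → Set ℓp′} {c : ℕ} (g : ∀ x → P x → B) →
              (∀ x Px → Q (g x Px)) →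
              (∀ x Px y Py → g x Px ~ g y Py → x ≈ y) →
              (∀ y → Q y → ∃ λ x → P x × (∀ x′ Px′ → x′ ≈ x → g x′ Px′ ~ y)) →
              HasClassCount _≈_ P c → HasClassCount _~_ Q c
  count-map g Qg g-inj g-sur (f , Pf , inj , sur) =
    (λ i → g (f i) (Pf i)) , (λ i → Qg _ _) , (λ i j r → inj i j (g-inj _ _ _ _ r)) ,
    λ y Qy → let (x , Px , r) = g-sur y Qy; (i , s) = sur x Px in i , r _ _ s

  -- Besides producing totals, this is combined with `count-unique` to turn an already known total
  -- into an equation for an unknown `m` or `n`.
  count-fibres : {P : A → Set ℓp} {Q : B → Set ℓp′} {m n : ℕ} (g : A → B) →
                 IsEquivalence _~_ → (∀ {x y} → x ≈ y → g x ~ g y) → (∀ x → P x → Q (g x)) →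
                 HasClassCount _~_ Q m →
                 (∀ y → Q y → HasClassCount _≈_ (λ x → P x × g x ~ y) n) →
                 HasClassCount _≈_ P (m ℕ.* n)
  count-fibres {P = P} {m = m} {n} g eq g-cong P⇒Q (h , Qh , injh , surh) fib =
    (λ k → uncurry F (remQuot n k)) , (λ k → proj₁ (PF (proj₁ (remQuot {m} n k)) _)) , inj , sur
    where
    open IsEquivalence eq
    F : Fin m → Fin n → A
    F i = proj₁ (fib (h i) (Qh i))
    PF : ∀ i j → P (F i j) × g (F i j) ~ h i
    PF i = proj₁ (proj₂ (fib (h i) (Qh i)))
    injF : ∀ i j i′ j′ → F i j ≈ F i′ j′ → (i , j) ≡ (i′ , j′)
    injF i j i′ j′ r
      with ≡.refl ← injh i i′ (trans (sym (proj₂ (PF i j))) (trans (g-cong r) (proj₂ (PF i′ j′))))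
      = cong (i ,_) (proj₁ (proj₂ (proj₂ (fib (h i) (Qh i)))) j j′ r)
    inj : ∀ k l → uncurry F (remQuot n k) ≈ uncurry F (remQuot n l) → k ≡ l
    inj k l r = ≡.trans (≡.sym (Finₚ.combine-remQuot {m} n k))
                (≡.trans (cong (uncurry combine) (injF _ _ _ _ r)) (Finₚ.combine-remQuot {m} n l))
    sur : ∀ x → P x → ∃ λ k → uncurry F (remQuot n k) ≈ x
    sur x Px with i , r ← surh (g x) (P⇒Q x Px)
             with j , s ← proj₂ (proj₂ (proj₂ (fib (h i) (Qh i)))) x (Px , sym r) =
      combine i j , subst (λ ij → uncurry F ij ≈ x) (≡.sym (Finₚ.remQuot-combine {m} i j)) s

module _ {_≈_ : A → A → Set ℓ} {_~_ : B → B → Set ℓ′} where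

  count-× : {P : A → Set ℓp} {Q : B → Set ℓp′} {m n : ℕ} → IsEquivalence _≈_ → IsEquivalence _~_ →
            (∀ {x y} → x ≈ y → P x → P y) →
            HasClassCount _≈_ P m → HasClassCount _~_ Q n →
            HasClassCount (Pointwise _≈_ _~_) (λ xy → P (proj₁ xy) × Q (proj₂ xy)) (m ℕ.* n)
  count-× {P = P} {Q = Q} eqA eqB P-resp CP CQ =
    count-fibres {_≈_ = Pointwise _≈_ _~_} proj₁ eqA proj₁ (λ _ → proj₁) CP λ x Px →
      count-map {_≈_ = _~_} {_~_ = Pointwise _≈_ _~_} {P = Q} (λ y _ → x , y)
        (λ y Qy → (Px , Qy) , A.refl) (λ _ _ _ _ → proj₂)
        (λ { (x′ , y) ((_ , Qy) , x′≈x) → y , Qy , λ y′ _ y′~y → A.sym x′≈x , y′~y })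
        CQ
    where
    module A = IsEquivalence eqA

-- Translation identifies every fibre of a surjective homomorphism S → T with its kernel.
module _ {g₁ g₂ h₁ h₂} (G : Group g₁ g₂) (H : Group h₁ h₂) where
  private
    module G = Group G
    module H = Group H
    module Gₚ = Groupₚ G
    module Hₚ = Groupₚ H

  count-preimage : {S : G.Carrier → Set ℓp} {T : H.Carrier → Set ℓp′} {Q : H.Carrier → Set ℓq} {s t c : ℕ}
    (φ : G.Carrier → H.Carrier) → Decidable G._≈_ → Decidable H._≈_ →
    (∀ {x y} → x G.≈ y → S x → S y) → (∀ {x y} → S x → S y → S (x G.∙ y)) → (∀ {x} → S x → S (x G.⁻¹)) →
    (∀ {x y} → x G.≈ y → φ x H.≈ φ y) → (∀ x y → φ (x G.∙ y) H.≈ φ x H.∙ φ y) →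
    (∀ x → S x → T (φ x)) → (∀ y → T y → ∃ λ x → S x × φ x H.≈ y) →
    (∀ {x y} → x H.≈ y → Q x → Q y) → (∀ y → Q y → T y) →
    HasClassCount G._≈_ S s → HasClassCount H._≈_ T t → HasClassCount H._≈_ Q c →
    ∃ λ k → t ℕ.* k ≡ s × HasClassCount G._≈_ (λ x → S x × Q (φ x)) (c ℕ.* k)
  count-preimage {S = S} {T} φ _G≟_ _H≟_ S-resp S-∙ S-⁻¹ φ-cong φ-∙ φ-T φ-sur Q-resp Q⇒T CS CT CQ
    -- `k` is the size of the kernel within `S`. Fibring `S` over all of `T` gives `t * k ≡ s`;
    -- fibring only over `Q` gives the count asked for.
    with k , CK ← count-filter {Q = λ x → φ x H.≈ H.ε} G.isEquivalence _G≟_ S-resp (λ x → φ x H≟ H.ε)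
                    (λ r s → H.trans (H.sym (φ-cong r)) s) CS
    = k , count-unique G.isEquivalence (count-fibres φ H.isEquivalence φ-cong φ-T CT fibre) CS
    , count-fibres φ H.isEquivalence φ-cong (λ x → proj₂) CQ λ y Qy →
        count-cong {_~_ = G._≈_} (λ { x (Sx , r) → (Sx , Q-resp (H.sym r) Qy) , r }) (λ { x ((Sx , _) , r) → Sx , r })
          (fibre y (Q⇒T y Qy))
    where
    fibre : ∀ y → T y → HasClassCount G._≈_ (λ x → S x × φ x H.≈ y) k
    fibre y Ty with x₀ , Sx₀ , r₀ ← φ-sur y Ty =
      count-map {_≈_ = G._≈_} {_~_ = G._≈_} (λ x _ → x G.∙ x₀)
        (λ { x (Sx , r) → S-∙ Sx Sx₀ , H.trans (φ-∙ x x₀) (H.trans (H.∙-cong r r₀) (H.identityˡ y)) })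
        (λ x _ y _ r → Gₚ.∙-cancelʳ x₀ x y r)
        (λ { z (Sz , r) → z G.∙ x₀ G.⁻¹
           , (S-∙ Sz (S-⁻¹ Sx₀)
           -- Multiplying by `φ x₀ ≈ y` on the right and cancelling `y` avoids evaluating `φ` at an
           -- inverse.
           , Hₚ.∙-cancelʳ y _ _ (H.trans (H.∙-congˡ (H.sym r₀)) (H.trans (H.sym (φ-∙ _ x₀))
               (H.trans (φ-cong (Gₚ.//-rightDividesˡ x₀ z)) (H.trans r (H.sym (H.identityˡ y)))))))
           , λ x′ _ s → G.trans (G.∙-congʳ s) (Gₚ.//-rightDividesˡ x₀ z) })
        CK

-- The ring

module Local (K : CommutativeRing 0ℓ 0ℓ) (finite : IsFiniteRing K)
             (J : CommutativeRing.Carrier K → Set) (three : HasExactlyThreeIdeals K J) where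

  open CommutativeRing K hiding (zero)
  open Ringₚ ring using (-1*x≈-x; [y-z]x≈yx-zx; x[y-z]≈xy-xz)
  open Groupₚ +-group using (x∙y⁻¹≈ε⇒x≈y; x≈y⇒x∙y⁻¹≈ε; ⁻¹-anti-homo-//; //-rightDividesˡ; //-rightDividesʳ)
  open CommutativeSemigroupₚ *-commutativeSemigroup using (interchange)
  open SetoidReasoning setoid

  _≟_ : Decidable _≈_
  _≟_ = proj₁ finite

  J-resp : ∀ {x y} → x ≈ y → J x → J y
  J-resp = proj₁ (proj₁ three)

  J-0 : J 0#
  J-0 = proj₁ (proj₂ (proj₁ three))

  J-+ : ∀ {x y} → J x → J y → J (x + y)
  J-+ = proj₁ (proj₂ (proj₂ (proj₁ three)))

  J-* : ∀ r {x} → J x → J (r * x)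
  J-* = proj₂ (proj₂ (proj₂ (proj₁ three)))

  J-*ʳ : ∀ {x} r → J x → J (x * r)
  J-*ʳ r Jx = J-resp (*-comm r _) (J-* r Jx)

  J-neg : ∀ {x} → J x → J (- x)
  J-neg Jx = J-resp (-1*x≈-x _) (J-* (- 1#) Jx)

  x-y+y≈x : ∀ x y → (x - y) + y ≈ x
  x-y+y≈x x y = //-rightDividesˡ y x

  -- The principal ideal of `x`. The classification of ideals is only ever applied to these.
  multiples : Carrier → Carrier → Set
  multiples x y = ∃ λ r → y ≈ r * x

  multiples-isIdeal : ∀ x → IsIdeal K (multiples x)
  multiples-isIdeal x =
    (λ { y≈z (r , y≈) → r , trans (sym y≈z) y≈ }) , (0# , sym (zeroˡ x)) ,
    (λ { (r , y≈) (s , z≈) → r + s , trans (+-cong y≈ z≈) (sym (distribʳ x r s)) }) ,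
    λ { t (r , y≈) → t * r , trans (*-congˡ y≈) (sym (*-assoc t r x)) }

  J∌1 : ¬ J 1#
  J∌1 J1 = proj₁ (proj₂ (proj₂ three)) λ x → (λ _ → tt) , (λ _ → J-resp (*-identityʳ x) (J-* x J1))

  unit∉J : ∀ {x} → IsUnit K x → ¬ J x
  unit∉J (y , xy≈1) Jx = J∌1 (J-resp xy≈1 (J-*ʳ y Jx))

  -- The principal ideal of `x` is zero, `J` or everything; the first two cases put `x` in `J`, the
  -- last makes 1 a multiple of `x`. As units avoid `J`, this also decides membership in `J`, which
  -- is given only as a predicate.
  unit⊎J : ∀ x → IsUnit K x ⊎ J x
  unit⊎J x with proj₂ (proj₂ (proj₂ three)) (multiples x) (multiples-isIdeal x)
  ... | inj₁ zero!        = inj₂ (J-resp (sym (proj₁ (zero! x) (1# , sym (*-identityˡ x)))) J-0)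
  ... | inj₂ (inj₁ J!)    = inj₂ (proj₁ (J! x) (1# , sym (*-identityˡ x)))
  ... | inj₂ (inj₂ whole) with r , 1≈ ← proj₂ (whole 1#) tt = inj₁ (r , trans (*-comm x r) (sym 1≈))

  J? : ∀ x → Dec (J x)
  J? x with unit⊎J x
  ... | inj₁ u  = no (unit∉J u)
  ... | inj₂ Jx = yes Jx

  ∉J⇒unit : ∀ {x} → ¬ J x → IsUnit K x
  ∉J⇒unit {x} ¬Jx with unit⊎J x
  ... | inj₁ u  = u
  ... | inj₂ Jx = ⊥-elim (¬Jx Jx)

  unit? : ∀ x → Dec (IsUnit K x)
  unit? x = map′ ∉J⇒unit unit∉J (¬? (J? x))

  unit-resp : ∀ {x y} → x ≈ y → IsUnit K x → IsUnit K y
  unit-resp x≈y (z , xz≈1) = z , trans (*-congʳ (sym x≈y)) xz≈1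

  unit-1 : IsUnit K 1#
  unit-1 = 1# , *-identityˡ 1#

  unit-* : ∀ {x y} → IsUnit K x → IsUnit K y → IsUnit K (x * y)
  unit-* {x} {y} (x′ , xx′) (y′ , yy′) = x′ * y′ , (begin
    (x * y) * (x′ * y′) ≈⟨ interchange x y x′ y′ ⟩
    (x * x′) * (y * y′) ≈⟨ *-cong xx′ yy′ ⟩
    1# * 1#             ≈⟨ *-identityˡ 1# ⟩
    1#                  ∎)

  unit-inverse : ∀ {x} (u : IsUnit K x) → IsUnit K (proj₁ u)
  unit-inverse {x} (y , xy≈1) = x , trans (*-comm y x) xy≈1

  inverse-* : ∀ {x} (u : IsUnit K x) y → proj₁ u * (x * y) ≈ y
  inverse-* {x} (x′ , xx′) y = begin
    x′ * (x * y) ≈⟨ *-assoc x′ x y ⟨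
    x′ * x * y   ≈⟨ *-congʳ (trans (*-comm x′ x) xx′) ⟩
    1# * y       ≈⟨ *-identityˡ y ⟩
    y            ∎

  *-inverse : ∀ {x} (u : IsUnit K x) y → x * (proj₁ u * y) ≈ y
  *-inverse u y = inverse-* (unit-inverse u) y

  unit-cancel : ∀ {x y z} → IsUnit K x → y * x ≈ z * x → y ≈ z
  unit-cancel {x} {y} {z} u yx≈zx = begin
    y                  ≈⟨ inverse-* u y ⟨
    proj₁ u * (x * y)  ≈⟨ *-congˡ (trans (*-comm x y) (trans yx≈zx (*-comm z x))) ⟩
    proj₁ u * (x * z)  ≈⟨ inverse-* u z ⟩
    z                  ∎

  ann⇒J : ∀ {r x} → ¬ x ≈ 0# → r * x ≈ 0# → J r
  ann⇒J {r} {x} x≉0 rx≈0 with unit⊎J r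
  ... | inj₂ Jr = Jr
  ... | inj₁ u  = ⊥-elim (x≉0 (trans (sym (inverse-* u x)) (trans (*-congˡ rx≈0) (zeroʳ _))))

  J-generated : ∀ {x} → J x → ¬ x ≈ 0# → ∀ y → J y → multiples x y
  J-generated {x} Jx x≉0 y Jy with proj₂ (proj₂ (proj₂ three)) (multiples x) (multiples-isIdeal x)
  ... | inj₁ zero!        = ⊥-elim (x≉0 (proj₁ (zero! x) (1# , sym (*-identityˡ x))))
  ... | inj₂ (inj₁ J!)    = proj₂ (J! y) Jy
  -- A contradictory case, since `x` would be a unit in `J`, but it supplies the multiple directly.
  ... | inj₂ (inj₂ whole) = proj₂ (whole y) tt

  -- If xy ≠ 0 then J = (xy), so x = sxy and x(1 - sy) = 0 with 1 - sy a unit.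
  J²≈0 : ∀ {x y} → J x → J y → x * y ≈ 0#
  J²≈0 {x} {y} Jx Jy with (x * y) ≟ 0#
  ... | yes xy≈0 = xy≈0
  ... | no  xy≉0 with s , x≈ ← J-generated (J-* x Jy) xy≉0 x Jx =
    ⊥-elim (J∌1 (J-resp (x-y+y≈x 1# (s * y)) (J-+ (ann⇒J x≉0 annihilates) (J-* s Jy))))
    where
    x≉0 : ¬ x ≈ 0#
    x≉0 x≈0 = xy≉0 (trans (*-congʳ x≈0) (zeroˡ y))
    annihilates : (1# - s * y) * x ≈ 0#
    annihilates = begin
      (1# - s * y) * x      ≈⟨ [y-z]x≈yx-zx x 1# (s * y) ⟩
      1# * x - s * y * x    ≈⟨ +-cong (*-identityˡ x) (-‿cong (trans (*-assoc s y x) (*-congˡ (*-comm y x)))) ⟩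
      x - s * (x * y)       ≈⟨ x≈y⇒x∙y⁻¹≈ε x≈ ⟩
      0#                    ∎

  -- That `J` is not the zero ideal is a bare negation; searching the finite list of ring elements
  -- turns it into a witness, the generator used in `count-J`.
  J-nonzero : ∃ λ x → J x × ¬ x ≈ 0#
  J-nonzero with N , f , _ , _ , sur ← proj₂ finite
            with Finₚ.any? (λ i → J? (f i) ×-dec ¬? (f i ≟ 0#))
  ... | yes (i , Jfi , fi≉0) = f i , Jfi , fi≉0
  ... | no none = ⊥-elim (proj₁ (proj₂ three) λ x → J⇒0 x , λ x≈0 → J-resp (sym x≈0) J-0)
    where
    J⇒0 : ∀ x → J x → x ≈ 0#
    J⇒0 x Jx with i , fi≈x ← sur x tt with f i ≟ 0#
    ... | yes fi≈0 = trans (sym fi≈x) fi≈0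
    ... | no  fi≉0 = ⊥-elim (none (i , J-resp (sym fi≈x) Jx , fi≉0))

  _≈ᴶ_ : Carrier → Carrier → Set
  x ≈ᴶ y = J (x - y)

  ≈⇒≈ᴶ : ∀ {x y} → x ≈ y → x ≈ᴶ y
  ≈⇒≈ᴶ x≈y = J-resp (sym (x≈y⇒x∙y⁻¹≈ε x≈y)) J-0

  ≈ᴶ-isEquivalence : IsEquivalence _≈ᴶ_
  ≈ᴶ-isEquivalence = record
    { refl  = ≈⇒≈ᴶ refl
    ; sym   = λ {x} {y} r → J-resp (⁻¹-anti-homo-// x y) (J-neg r)
    ; trans = λ {x} {y} {z} r s → J-resp (begin
        (x - y) + (y - z)  ≈⟨ +-assoc (x - y) y (- z) ⟨
        (x - y) + y - z    ≈⟨ +-congʳ (x-y+y≈x x y) ⟩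
        x - z              ∎) (J-+ r s)
    }

  module ≈ᴶ = IsEquivalence ≈ᴶ-isEquivalence

  J-resp-≈ᴶ : ∀ {x y} → x ≈ᴶ y → J x → J y
  J-resp-≈ᴶ {x} {y} r Jx = J-resp (x-y+y≈x y x) (J-+ (≈ᴶ.sym r) Jx)

  ≈ᴶ-*ˡ : ∀ r {x y} → x ≈ᴶ y → (r * x) ≈ᴶ (r * y)
  ≈ᴶ-*ˡ r {x} {y} s = J-resp (x[y-z]≈xy-xz r x y) (J-* r s)

  ≈ᴶ-*ʳ : ∀ r {x y} → x ≈ᴶ y → (x * r) ≈ᴶ (y * r)
  ≈ᴶ-*ʳ r {x} {y} s = J-resp ([y-z]x≈yx-zx r x y) (J-*ʳ r s)

  J∖0 : Carrier → Set
  J∖0 x = J x × ¬ x ≈ 0#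

  J∖0-resp : ∀ {x y} → x ≈ y → J∖0 x → J∖0 y
  J∖0-resp x≈y (Jx , x≉0) = J-resp x≈y Jx , λ y≈0 → x≉0 (trans x≈y y≈0)

  J∖0-* : ∀ {u x} → IsUnit K u → J∖0 x → J∖0 (u * x)
  J∖0-* {u} {x} U (Jx , x≉0) = J-* u Jx , λ ux≈0 →
    x≉0 (trans (sym (inverse-* U x)) (trans (*-congˡ ux≈0) (zeroʳ _)))

  count-0 : HasClassCount _≈_ (_≈ 0#) 1
  count-0 = count-singleton {_~_ = _≈_} 0# refl (λ _ → sym)

  module _ {q : ℕ} (quotient : QuotientHasSize K J q) where

    count-J : HasClassCount _≈_ J q
    count-J with π , Jπ , π≉0 ← J-nonzero =
      count-map {_≈_ = _≈ᴶ_} {_~_ = _≈_} (λ x _ → x * π)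
        (λ x _ → J-* x Jπ)
        (λ x _ y _ r → ann⇒J π≉0 (trans ([y-z]x≈yx-zx π x y) (x≈y⇒x∙y⁻¹≈ε r)))
        (λ y Jy → let (r , y≈) = J-generated Jπ π≉0 y Jy in
           -- Multiplication by the generator is well defined on cosets because J² = 0.
           r , tt , λ x _ s → trans (x∙y⁻¹≈ε⇒x≈y _ _ (trans (sym ([y-z]x≈yx-zx π x r)) (J²≈0 s Jπ))) (sym y≈))
        quotient

    count-coset : ∀ y → HasClassCount _≈_ (_≈ᴶ y) q
    count-coset y = count-map {_≈_ = _≈_} {_~_ = _≈_} (λ x _ → x + y)
      (λ x Jx → J-resp (sym (//-rightDividesʳ y x)) Jx)
      (λ x _ z _ r → Groupₚ.∙-cancelʳ +-group y x z r)
      (λ z r → z - y , r , λ x _ s → trans (+-congʳ s) (x-y+y≈x z y))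
      count-J

    count-K : HasClassCount _≈_ (λ _ → ⊤) (q ℕ.* q)
    count-K = count-fibres id ≈ᴶ-isEquivalence ≈⇒≈ᴶ (λ _ _ → tt) quotient λ y _ →
      count-cong {_~_ = _≈_} (λ _ r → tt , r) (λ _ → proj₂) (count-coset y)

    count-units : HasClassCount _≈_ (IsUnit K) (q ℕ.* q ∸ q)
    count-units = count-cong {_~_ = _≈_} (λ _ p → ∉J⇒unit (proj₂ p)) (λ _ u → tt , unit∉J u)
      (count-∖ isEquivalence _≟_ (λ _ _ → tt) J? J-resp (λ _ _ → tt) count-K count-J)

    count-J∖0 : HasClassCount _≈_ J∖0 (q ∸ 1)
    count-J∖0 = count-∖ isEquivalence _≟_ J-resp (_≟ 0#) (λ r s → trans (sym r) s)
      (λ x x≈0 → J-resp (sym x≈0) J-0) count-J count-0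

    count-∉J/J : HasClassCount _≈ᴶ_ (λ x → ¬ J x) (q ∸ 1)
    count-∉J/J = count-cong {_~_ = _≈ᴶ_} (λ _ → proj₂) (λ _ ¬Jx → tt , ¬Jx)
      (count-∖ ≈ᴶ-isEquivalence (λ x y → J? (x - y)) (λ _ _ → tt) J? J-resp-≈ᴶ (λ _ _ → tt) quotient
        (count-singleton {_~_ = _≈ᴶ_} 0# J-0 (λ x Jx → J-resp (sym (+-identityˡ (- x))) (J-neg Jx))))

    -- The elements 0 and 1 lie in different cosets. The bound makes `q ∸ 1` a positive divisor in
    -- the parameters.
    2≤q : 2 ≤ q
    2≤q = go (proj₁ (index 0#)) (proj₁ (index 1#)) λ i≡j →
      J∌1 (J-resp (trans (+-congˡ (Groupₚ.ε⁻¹≈ε +-group)) (+-identityʳ 1#))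
        (≈ᴶ.trans (≈ᴶ.sym (proj₂ (index 1#))) (subst (λ k → proj₁ quotient k ≈ᴶ 0#) i≡j (proj₂ (index 0#)))))
      where
      index : ∀ x → ∃ λ i → proj₁ quotient i ≈ᴶ x
      index x = proj₂ (proj₂ (proj₂ quotient)) x tt
      go : ∀ {q} (i j : Fin q) → i ≢ j → 2 ≤ q
      go {suc (suc q)} _ _ _ = s≤s (s≤s z≤n)
      go {1} zero zero i≢j = ⊥-elim (i≢j ≡.refl)

-- The symplectic form

module Symplectic (K : CommutativeRing 0ℓ 0ℓ) (e : ℕ) where

  open CommutativeRing K hiding (zero)
  open Ringₚ ring using (-1*x≈-x; -‿distribʳ-*; x[y-z]≈xy-xz)
  open Groupₚ +-group using (x≈y⇒x∙y⁻¹≈ε; ⁻¹-anti-homo-//; ⁻¹-involutive; ε⁻¹≈ε; //-rightDividesˡ; //-rightDividesʳ)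
  open AbelianGroupₚ +-abelianGroup using (⁻¹-∙-comm)
  open CommutativeSemigroupₚ +-commutativeSemigroup using (interchange)
  open Sumₚ semiring using (sum; sum-cong-≋; ∑-distrib-+; *-distribˡ-sum; sum-replicate-zero)
  open SetoidReasoning setoid

  ⟨_,_⟩ : Tuple K e → Tuple K e → Carrier
  ⟨ a , b ⟩ = symp K e a b

  _≋_ : Tuple K e → Tuple K e → Set
  a ≋ b = ∀ i → a i ≈ b i

  _⊕_ : Tuple K e → Tuple K e → Tuple K e
  (a ⊕ b) i = a i + b i

  _⊙_ : Carrier → Tuple K e → Tuple K e
  (r ⊙ a) i = r * a i

  symp-cong : ∀ {a a′ b b′} → a ≋ a′ → b ≋ b′ → ⟨ a , b ⟩ ≈ ⟨ a′ , b′ ⟩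
  symp-cong a≋ b≋ = sum-cong-≋ {e} λ i → +-cong (*-cong (a≋ _) (b≋ _)) (-‿cong (*-cong (a≋ _) (b≋ _)))

  symp-⊕ˡ : ∀ a b c → ⟨ a ⊕ b , c ⟩ ≈ ⟨ a , c ⟩ + ⟨ b , c ⟩
  symp-⊕ˡ a b c = trans (sum-cong-≋ {e} λ i → begin
      (a (i ↑ˡ e) + b (i ↑ˡ e)) * c (e ↑ʳ i) - (a (e ↑ʳ i) + b (e ↑ʳ i)) * c (i ↑ˡ e)
        ≈⟨ +-cong (distribʳ _ _ _) (trans (-‿cong (distribʳ _ _ _)) (sym (⁻¹-∙-comm _ _))) ⟩
      (a (i ↑ˡ e) * c (e ↑ʳ i) + b (i ↑ˡ e) * c (e ↑ʳ i)) + (- (a (e ↑ʳ i) * c (i ↑ˡ e)) - b (e ↑ʳ i) * c (i ↑ˡ e))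
        ≈⟨ interchange _ _ _ _ ⟩
      (a (i ↑ˡ e) * c (e ↑ʳ i) - a (e ↑ʳ i) * c (i ↑ˡ e)) + (b (i ↑ˡ e) * c (e ↑ʳ i) - b (e ↑ʳ i) * c (i ↑ˡ e)) ∎)
    (∑-distrib-+ {e} _ _)

  symp-⊙ˡ : ∀ r a b → ⟨ r ⊙ a , b ⟩ ≈ r * ⟨ a , b ⟩
  symp-⊙ˡ r a b = trans (sum-cong-≋ {e} λ i →
      trans (+-cong (*-assoc r _ _) (-‿cong (*-assoc r _ _))) (sym (x[y-z]≈xy-xz r _ _)))
    (sym (*-distribˡ-sum {e} r _))

  symp-antisym : ∀ a b → ⟨ b , a ⟩ ≈ - ⟨ a , b ⟩
  symp-antisym a b = trans (trans (sum-cong-≋ {e} λ i → begin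
      b (i ↑ˡ e) * a (e ↑ʳ i) - b (e ↑ʳ i) * a (i ↑ˡ e)  ≈⟨ +-cong (*-comm _ _) (-‿cong (*-comm _ _)) ⟩
      a (e ↑ʳ i) * b (i ↑ˡ e) - a (i ↑ˡ e) * b (e ↑ʳ i)  ≈⟨ ⁻¹-anti-homo-// _ _ ⟨
      -- The sign is written as a factor so that distributivity can pull it out of the sum.
      - (a (i ↑ˡ e) * b (e ↑ʳ i) - a (e ↑ʳ i) * b (i ↑ˡ e)) ≈⟨ -1*x≈-x _ ⟨
      - 1# * (a (i ↑ˡ e) * b (e ↑ʳ i) - a (e ↑ʳ i) * b (i ↑ˡ e)) ∎)
    (sym (*-distribˡ-sum {e} (- 1#) _))) (-1*x≈-x _)

  symp-self : ∀ a → ⟨ a , a ⟩ ≈ 0#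
  symp-self a = trans (sum-cong-≋ {e} λ i → x≈y⇒x∙y⁻¹≈ε (*-comm _ _)) (sum-replicate-zero e)

  symp-⊕ʳ : ∀ a b c → ⟨ a , b ⊕ c ⟩ ≈ ⟨ a , b ⟩ + ⟨ a , c ⟩
  symp-⊕ʳ a b c = begin
    ⟨ a , b ⊕ c ⟩             ≈⟨ symp-antisym (b ⊕ c) a ⟩
    - ⟨ b ⊕ c , a ⟩           ≈⟨ -‿cong (symp-⊕ˡ b c a) ⟩
    - (⟨ b , a ⟩ + ⟨ c , a ⟩)  ≈⟨ ⁻¹-∙-comm _ _ ⟨
    - ⟨ b , a ⟩ - ⟨ c , a ⟩    ≈⟨ +-cong (symp-antisym b a) (symp-antisym c a) ⟨
    ⟨ a , b ⟩ + ⟨ a , c ⟩      ∎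

  symp-⊙ʳ : ∀ r a b → ⟨ a , r ⊙ b ⟩ ≈ r * ⟨ a , b ⟩
  symp-⊙ʳ r a b = begin
    ⟨ a , r ⊙ b ⟩      ≈⟨ symp-antisym (r ⊙ b) a ⟩
    - ⟨ r ⊙ b , a ⟩    ≈⟨ -‿cong (symp-⊙ˡ r b a) ⟩
    - (r * ⟨ b , a ⟩)  ≈⟨ -‿distribʳ-* r _ ⟩
    r * - ⟨ b , a ⟩    ≈⟨ *-congˡ (symp-antisym b a) ⟨
    r * ⟨ a , b ⟩      ∎

  -- Measures how far the pair of values (s, t) of the two forms is from the line t = rs.
  symp-diff : ∀ r a a′ b → ⟨ a′ , b ⟩ - r * ⟨ a , b ⟩ ≈ ⟨ (λ k → a′ k - r * a k) , b ⟩
  symp-diff r a a′ b = begin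
    ⟨ a′ , b ⟩ - r * ⟨ a , b ⟩                       ≈⟨ +-congʳ (symp-cong {b = b} (λ k → sym (//-rightDividesˡ (r * a k) (a′ k))) (λ _ → refl)) ⟩
    ⟨ a″ ⊕ (r ⊙ a) , b ⟩ - r * ⟨ a , b ⟩             ≈⟨ +-congʳ (trans (symp-⊕ˡ a″ (r ⊙ a) b) (+-congˡ (symp-⊙ˡ r a b))) ⟩
    ⟨ a″ , b ⟩ + r * ⟨ a , b ⟩ - r * ⟨ a , b ⟩       ≈⟨ //-rightDividesʳ (r * ⟨ a , b ⟩) _ ⟩
    ⟨ a″ , b ⟩                                       ∎
    where
    a″ : Tuple K e
    a″ k = a′ k - r * a k

  -- Stated for any ideal: at `J` it gives membership, at the zero ideal it gives vanishing of the
  -- form.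
  symp-ideal : ∀ {I} → IsIdeal K I → ∀ a b → (∀ k l → I (a k * b l)) → I ⟨ a , b ⟩
  symp-ideal {I} (I-resp , I-0 , I-+ , I-*) a b Iab = sum-ideal {e} λ i →
    I-+ (Iab (i ↑ˡ e) (e ↑ʳ i)) (I-resp (-1*x≈-x _) (I-* (- 1#) (Iab (e ↑ʳ i) (i ↑ˡ e))))
    where
    sum-ideal : ∀ {n} {t : Fin n → Carrier} → (∀ i → I (t i)) → I (sum t)
    sum-ideal {zero}  It = I-0
    sum-ideal {suc n} It = I-+ (It zero) (sum-ideal (It ∘ suc))

  single : ∀ {n} → Fin n → Carrier → Fin n → Carrier
  single zero    x zero    = x
  single zero    x (suc k) = 0#
  single (suc i) x zero    = 0#
  single (suc i) x (suc k) = single i x k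

  sum-single : ∀ {n} (c : Fin n → Carrier) i x → sum (λ k → c k * single i x k) ≈ c i * x
  sum-single {suc n} c zero x = trans (+-congˡ (trans (sum-cong-≋ {n} λ k → zeroʳ _) (sum-replicate-zero n))) (+-identityʳ _)
  sum-single {suc n} c (suc i) x = trans (+-cong (zeroʳ _) (sum-single (c ∘ suc) i x)) (+-identityˡ _)

  -- The symplectic partner of a coordinate: `x` sits at the matching position of the other half,
  -- negated when the given coordinate belongs to the second half, so that pairing with it reads off
  -- that coordinate times `x`.
  dual-entry : Fin e ⊎ Fin e → Carrier → Fin e ⊎ Fin e → Carrier
  dual-entry (inj₁ i) x (inj₁ k) = 0#
  dual-entry (inj₁ i) x (inj₂ k) = single i x k
  dual-entry (inj₂ i) x (inj₁ k) = - single i x k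
  dual-entry (inj₂ i) x (inj₂ k) = 0#

  dual : Fin (e ℕ.+ e) → Carrier → Tuple K e
  dual j x k = dual-entry (splitAt e j) x (splitAt e k)

  symp-dual : ∀ a j x → ⟨ a , dual j x ⟩ ≈ a j * x
  symp-dual a j x = trans (by-half (splitAt e j)) (*-congʳ (reflexive (cong a (Finₚ.join-splitAt e e j))))
    where
    x-y*0≈x : ∀ x y → x - y * 0# ≈ x
    x-y*0≈x x y = trans (+-congˡ (trans (-‿cong (zeroʳ y)) ε⁻¹≈ε)) (+-identityʳ x)
    x*0-y*-z≈yz : ∀ x y z → x * 0# - y * - z ≈ y * z
    x*0-y*-z≈yz x y z = trans (+-cong (zeroʳ x) (trans (-‿cong (sym (-‿distribʳ-* y z))) (⁻¹-involutive _))) (+-identityˡ _)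
    by-half : ∀ s → ⟨ a , (λ k → dual-entry s x (splitAt e k)) ⟩ ≈ a (join e e s) * x
    by-half (inj₁ i) = trans (sum-cong-≋ {e} λ k → begin
        a (k ↑ˡ e) * dual-entry (inj₁ i) x (splitAt e (e ↑ʳ k)) - a (e ↑ʳ k) * dual-entry (inj₁ i) x (splitAt e (k ↑ˡ e))
          ≡⟨ cong₂ (λ s t → a (k ↑ˡ e) * dual-entry (inj₁ i) x s - a (e ↑ʳ k) * dual-entry (inj₁ i) x t)
                   (Finₚ.splitAt-↑ʳ e e k) (Finₚ.splitAt-↑ˡ e k e) ⟩
        a (k ↑ˡ e) * single i x k - a (e ↑ʳ k) * 0#  ≈⟨ x-y*0≈x _ _ ⟩
        a (k ↑ˡ e) * single i x k ∎) (sum-single (a ∘ (_↑ˡ e)) i x)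
    by-half (inj₂ i) = trans (sum-cong-≋ {e} λ k → begin
        a (k ↑ˡ e) * dual-entry (inj₂ i) x (splitAt e (e ↑ʳ k)) - a (e ↑ʳ k) * dual-entry (inj₂ i) x (splitAt e (k ↑ˡ e))
          ≡⟨ cong₂ (λ s t → a (k ↑ˡ e) * dual-entry (inj₂ i) x s - a (e ↑ʳ k) * dual-entry (inj₂ i) x t)
                   (Finₚ.splitAt-↑ʳ e e k) (Finₚ.splitAt-↑ˡ e k e) ⟩
        a (k ↑ˡ e) * 0# - a (e ↑ʳ k) * - single i x k  ≈⟨ x*0-y*-z≈yz _ _ _ ⟩
        a (e ↑ʳ k) * single i x k ∎) (sum-single (a ∘ (e ↑ʳ_)) i x)

  dual-ideal : ∀ {I} → IsIdeal K I → ∀ j {x} → I x → ∀ k → I (dual j x k)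
  dual-ideal {I} (I-resp , I-0 , _ , I-*) j {x} Ix k = entry (splitAt e j) (splitAt e k)
    where
    single-ideal : ∀ {n} (i k : Fin n) → I (single i x k)
    single-ideal zero    zero    = Ix
    single-ideal zero    (suc k) = I-0
    single-ideal (suc i) zero    = I-0
    single-ideal (suc i) (suc k) = single-ideal i k
    entry : ∀ s t → I (dual-entry s x t)
    entry (inj₁ i) (inj₁ k) = I-0
    entry (inj₁ i) (inj₂ k) = single-ideal i k
    entry (inj₂ i) (inj₁ k) = I-resp (-1*x≈-x _) (I-* (- 1#) (single-ideal i k))
    entry (inj₂ i) (inj₂ k) = I-0

-- The graph

module Graph (K : CommutativeRing 0ℓ 0ℓ) (finite : IsFiniteRing K)
             (J : CommutativeRing.Carrier K → Set) (three : HasExactlyThreeIdeals K J)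
             {q : ℕ} (quotient : QuotientHasSize K J q) (e : ℕ) where

  open CommutativeRing K hiding (zero)
  open Local K finite J three
  open Symplectic K e
  open Ringₚ ring using (-1*x≈-x)
  open Groupₚ +-group using (x∙y⁻¹≈ε⇒x≈y; //-rightDividesʳ; ∙-cancelʳ; ε⁻¹≈ε)
  open SetoidReasoning setoid

  tupleGroup : Group 0ℓ 0ℓ
  tupleGroup = Pointwise.group (Fin (e ℕ.+ e)) +-group

  pairGroup : Group 0ℓ 0ℓ
  pairGroup = DirectProduct.group +-group +-group

  module ≋ = Group tupleGroup

  _≋?_ : Decidable _≋_
  a ≋? b = Finₚ.all? (λ i → a i ≟ b i)

  J-ideal : IsIdeal K J
  J-ideal = proj₁ three

  whole-ideal : IsIdeal K (WholeRing K)
  whole-ideal = (λ _ _ → tt) , tt , (λ _ _ → tt) , (λ _ _ → tt)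

  zero-ideal : IsIdeal K (ZeroIdeal K)
  zero-ideal = (λ x≈y x≈0 → trans (sym x≈y) x≈0) , refl ,
    (λ x≈0 y≈0 → trans (+-cong x≈0 y≈0) (+-identityˡ 0#)) ,
    (λ r x≈0 → trans (*-congˡ x≈0) (zeroʳ r))

  AllIn : (Carrier → Set) → Tuple K e → Set
  AllIn I b = ∀ k → I (b k)

  AllJ-resp : ∀ {a b} → a ≋ b → AllIn J a → AllIn J b
  AllJ-resp a≋b Ja k = J-resp (a≋b k) (Ja k)

  AllJ? : ∀ a → Dec (AllIn J a)
  AllJ? a = Finₚ.all? (J? ∘ a)

  ¬AllJ⇒unit : ∀ {a} → ¬ AllIn J a → ∃ λ i → IsUnit K (a i)
  ¬AllJ⇒unit {a} ¬Ja with Finₚ.any? (unit? ∘ a)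
  ... | yes u   = u
  ... | no none = ⊥-elim (¬Ja λ k → [ (λ u → ⊥-elim (none (k , u))) , id ]′ (unit⊎J (a k)))

  unit⇒¬AllJ : ∀ {a} → (∃ λ i → IsUnit K (a i)) → ¬ AllIn J a
  unit⇒¬AllJ (i , u) Ja = unit∉J u (Ja i)

  -- Instantiated twice: equality in K yields the vertices, congruence modulo `J` yields the
  -- projective points below them.
  module Scaling (R : Carrier → Carrier → Set) (R-isEquivalence : IsEquivalence R) (R? : Decidable R)
                 (≈⇒R : ∀ {x y} → x ≈ y → R x y)
                 (R-*ˡ : ∀ r {x y} → R x y → R (r * x) (r * y))
                 (R-unit : ∀ {x y} → R x y → IsUnit K x → IsUnit K y) where

    private
      module R = IsEquivalence R-isEquivalence

    _~_ : YVertex K e → YVertex K e → Set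
    (a , _) ~ (b , _) = ∃ λ l → IsUnit K l × (∀ i → R (a i) (l * b i))

    ~-isEquivalence : IsEquivalence _~_
    ~-isEquivalence = record
      { refl  = 1# , unit-1 , λ i → ≈⇒R (sym (*-identityˡ _))
      ; sym   = λ { (l , L , r) → proj₁ L , unit-inverse L , λ i →
                    R.sym (R.trans (R-*ˡ (proj₁ L) (r i)) (≈⇒R (inverse-* L _))) }
      ; trans = λ { (l , L , r) (m , M , s) → l * m , unit-* L M , λ i →
                    R.trans (r i) (R.trans (R-*ˡ l (s i)) (≈⇒R (sym (*-assoc l m _)))) }
      }

    -- The unit entry `b i` determines the scalar up to `R`, as the quotient of `a i` by `b i`.
    -- Testing this one candidate decides the relation.
    ratio-scales : ∀ (a b : Tuple K e) i (B : IsUnit K (b i)) → (∃ λ l → IsUnit K l × (∀ k → R (a k) (l * b k))) →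
                   IsUnit K (proj₁ B * a i) × (∀ k → R (a k) (proj₁ B * a i * b k))
    ratio-scales a b i B (l , L , r) =
      R-unit (R.sym l₀Rl) L ,
      λ k → R.trans (r k) (R.trans (≈⇒R (*-comm l (b k)))
              (R.trans (R-*ˡ (b k) (R.sym l₀Rl)) (≈⇒R (*-comm (b k) _))))
      where
      l₀Rl : R (proj₁ B * a i) l
      l₀Rl = R.trans (R-*ˡ (proj₁ B) (r i)) (≈⇒R (trans (*-congˡ (*-comm l (b i))) (inverse-* B l)))

    _~?_ : Decidable _~_
    (a , _) ~? (b , i , B) =
      map′ (λ { (L , r) → proj₁ B * a i , L , r }) (ratio-scales a b i B) (unit? (proj₁ B * a i) ×-dec Finₚ.all? (λ k → R? (a k) (proj₁ B * a i * b k)))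

  ≈ᴶ-unit : ∀ {x y} → x ≈ᴶ y → IsUnit K x → IsUnit K y
  ≈ᴶ-unit r u = ∉J⇒unit λ Jy → unit∉J u (J-resp-≈ᴶ (≈ᴶ.sym r) Jy)

  open Scaling _≈_ isEquivalence _≟_ id (λ r → *-congˡ) unit-resp public
    using (_~_; ~-isEquivalence; _~?_)
  open Scaling _≈ᴶ_ ≈ᴶ-isEquivalence (λ x y → J? (x - y)) ≈⇒≈ᴶ ≈ᴶ-*ˡ ≈ᴶ-unit public
    using () renaming (_~_ to _~ᴶ_; ~-isEquivalence to ~ᴶ-isEquivalence; _~?_ to _~ᴶ?_; ratio-scales to ratio-scalesᴶ)

  module ~ = IsEquivalence ~-isEquivalence
  module ~ᴶ = IsEquivalence ~ᴶ-isEquivalence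

  ~⇒~ᴶ : ∀ {x y} → x ~ y → x ~ᴶ y
  ~⇒~ᴶ (l , L , r) = l , L , λ i → ≈⇒≈ᴶ (r i)

  -- A vertex consists of the multiples of one tuple `b` by the units; they are pairwise distinct
  -- because `b` has a unit entry that can be cancelled.
  count-classes : {P : Tuple K e → Set} {n : ℕ} →
    (∀ {a b} → a ≋ b → P a → P b) → (∀ {l a} → IsUnit K l → P a → P (l ⊙ a)) →
    HasClassCount _≋_ (λ a → P a × ¬ AllIn J a) n →
    ∃ λ c → c ℕ.* (q ℕ.* q ∸ q) ≡ n × HasClassCount _~_ (P ∘ proj₁) c
  count-classes {P} {n} P-resp P-⊙ CP =
    proj₁ cover , count-unique ≋ᵛ-isEquivalence (count-fibres id ~-isEquivalence (λ {x} {y} → ≋ᵛ⇒~ x y) (λ _ → id) C′ fibre) CV , C′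
    where
    -- A vertex carries a chosen unit entry, which the comparison of tuples has to ignore.
    _≋ᵛ_ : YVertex K e → YVertex K e → Set
    x ≋ᵛ y = proj₁ x ≋ proj₁ y
    ≋ᵛ-isEquivalence : IsEquivalence _≋ᵛ_
    ≋ᵛ-isEquivalence = record { refl = ≋.refl ; sym = ≋.sym ; trans = ≋.trans }
    ≋ᵛ⇒~ : ∀ x y → x ≋ᵛ y → x ~ y
    ≋ᵛ⇒~ _ _ x≋y = 1# , unit-1 , λ i → trans (x≋y i) (sym (*-identityˡ _))
    CV : HasClassCount _≋ᵛ_ (P ∘ proj₁) n
    CV = count-map {_≈_ = _≋_} {_~_ = _≋ᵛ_} (λ { a (_ , ¬Ja) → a , ¬AllJ⇒unit ¬Ja })
      (λ _ → proj₁) (λ _ _ _ _ → id) (λ { (a , u) Pa → a , (Pa , unit⇒¬AllJ u) , λ _ _ → id }) CP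
    ~-P : ∀ x y → x ~ y → P (proj₁ y) → P (proj₁ x)
    ~-P _ _ (l , L , r) Py = P-resp (≋.sym r) (P-⊙ L Py)
    cover : ∃ (HasClassCount _~_ (λ x → ⊤ × ∃ λ j → proj₁ CV j ~ x))
    cover = count-covered ~-isEquivalence _~?_ (λ _ → yes tt) (λ _ _ → tt) (proj₁ CV)
    C′ : HasClassCount _~_ (P ∘ proj₁) (proj₁ cover)
    C′ = count-cong {_~_ = _~_}
      (λ { x (_ , j , r) → ~-P x (proj₁ CV j) (~.sym {proj₁ CV j} {x} r) (proj₁ (proj₂ CV) j) })
      (λ { x Px → let (j , r) = proj₂ (proj₂ (proj₂ CV)) x Px in tt , j , ≋ᵛ⇒~ (proj₁ CV j) x r }) (proj₂ cover)
    fibre : ∀ y → P (proj₁ y) → HasClassCount _≋ᵛ_ (λ x → P (proj₁ x) × x ~ y) (q ℕ.* q ∸ q)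
    fibre (b , i , B) Pb = count-map {_≈_ = _≈_} {_~_ = _≋ᵛ_}
      (λ l L → l ⊙ b , i , unit-* L B)
      (λ l L → P-⊙ L Pb , l , L , λ _ → refl)
      (λ l _ m _ r → unit-cancel B (r i))
      (λ { (a , _) (_ , l , L , r) → l , L , λ m _ m≈l k → trans (*-congʳ m≈l) (sym (r k)) })
      (count-units quotient)

  -- The two counts have the shape of a single lemma about an ideal, read at the whole ring and at
  -- `J`.
  count-vertices : {P : Tuple K e → Set} {n₁ n₂ : ℕ} → (∀ a → Dec (P a)) →
    (∀ {a b} → a ≋ b → P a → P b) → (∀ {l a} → IsUnit K l → P a → P (l ⊙ a)) →
    HasClassCount _≋_ (λ a → AllIn (WholeRing K) a × P a) n₁ →
    HasClassCount _≋_ (λ a → AllIn J a × P a) n₂ →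
    ∃ λ c → c ℕ.* (q ℕ.* q ∸ q) ≡ n₁ ∸ n₂ × HasClassCount _~_ (P ∘ proj₁) c
  count-vertices P? P-resp P-⊙ C₁ C₂ = count-classes P-resp P-⊙
    (count-cong {_~_ = _≋_} (λ { a ((_ , Pa) , ¬JPa) → Pa , λ Ja → ¬JPa (Ja , Pa) })
                            (λ { a (Pa , ¬Ja) → ((λ _ → tt) , Pa) , ¬Ja ∘ proj₁ })
      (count-∖ ≋.isEquivalence _≋?_ (λ { a≋b (_ , Pa) → (λ _ → tt) , P-resp a≋b Pa })
        (λ a → AllJ? a ×-dec P? a) (λ { a≋b (Ja , Pa) → AllJ-resp a≋b Ja , P-resp a≋b Pa })
        (λ { a (_ , Pa) → (λ _ → tt) , Pa }) C₁ C₂))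

  -- Tuples with prescribed values of the form

  count-AllIn : ∀ {I t} → HasClassCount _≈_ I t → HasClassCount _≋_ (AllIn I) (t ^ (e ℕ.+ e))
  count-AllIn = count-functions {_~_ = _≈_} (e ℕ.+ e)

  count-AllJ : HasClassCount _≋_ (AllIn J) (q ^ (e ℕ.+ e))
  count-AllJ = count-AllIn (count-J quotient)

  J∖0? : ∀ x → Dec (J∖0 x)
  J∖0? x = J? x ×-dec ¬? (x ≟ 0#)

  module _ {I : Carrier → Set} {t : ℕ} (I-ideal : IsIdeal K I) (J⊆I : ∀ {x} → J x → I x)
           (count-I : HasClassCount _≈_ I t) where
    private
      I-resp : ∀ {x y} → x ≈ y → I x → I y
      I-resp = proj₁ I-ideal
      I-+ : ∀ {x y} → I x → I y → I (x + y)
      I-+ = proj₁ (proj₂ (proj₂ I-ideal))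
      I-* : ∀ r {x} → I x → I (r * x)
      I-* = proj₂ (proj₂ (proj₂ I-ideal))
      I-neg : ∀ {x} → I x → I (- x)
      I-neg Ix = I-resp (-1*x≈-x _) (I-* (- 1#) Ix)
      symp-I : ∀ a b → AllIn I b → I ⟨ a , b ⟩
      symp-I a b Ib = symp-ideal I-ideal a b (λ k l → I-* (a k) (Ib l))

    -- Restricted to tuples over `I`, the form has image exactly `I`: every value is reached through
    -- the coordinate dual to the unit entry `a i`. Hence the kernel has index `t`.
    count-J∖0-symp : ∀ a i → IsUnit K (a i) → ∃ λ k → t ℕ.* k ≡ t ^ (e ℕ.+ e) ×
      HasClassCount _≋_ (λ b → AllIn I b × J∖0 ⟨ a , b ⟩) ((q ∸ 1) ℕ.* k)
    count-J∖0-symp a i A = count-preimage tupleGroup +-group (⟨ a ,_⟩) _≋?_ _≟_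
      (λ b≋c Ib k → I-resp (b≋c k) (Ib k)) (λ Ib Ic k → I-+ (Ib k) (Ic k)) (λ Ib k → I-neg (Ib k))
      (λ b≋c → symp-cong {a} (λ _ → refl) b≋c) (symp-⊕ʳ a) (symp-I a)
      (λ y Iy → dual i (proj₁ A * y) , dual-ideal I-ideal i (I-* _ Iy) , trans (symp-dual a i _) (*-inverse A y))
      J∖0-resp (λ _ → J⊆I ∘ proj₁) (count-AllIn count-I) count-I (count-J∖0 quotient)

    -- With a′ = r a + a″ and a″ᵢ = 0, ⟨a′,b⟩ - r⟨a,b⟩ = ⟨a″,b⟩ can be prescribed through the
    -- coordinate of b dual to j, and then ⟨a,b⟩ through the coordinate dual to i.
    count-J∖0-symp₂ : ∀ {I′ t′} → IsIdeal K I′ → (∀ {x} → J x → I′ x) → HasClassCount _≈_ I′ t′ →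
      ∀ a a′ i j r d → IsUnit K (a i) → a′ i ≈ r * a i → a′ j ≈ r * a j + d →
      (∀ b → AllIn I b → I′ (⟨ a′ , b ⟩ - r * ⟨ a , b ⟩)) →
      (∀ y → I′ y → ∃ λ x → I x × d * x ≈ y) →
      ∃ λ k → t ℕ.* t′ ℕ.* k ≡ t ^ (e ℕ.+ e) ×
        HasClassCount _≋_ (λ b → AllIn I b × J∖0 ⟨ a , b ⟩ × J∖0 ⟨ a′ , b ⟩) ((q ∸ 1) ℕ.* (q ∸ 1) ℕ.* k)
    count-J∖0-symp₂ {I′} {t′} I′-ideal J⊆I′ count-I′ a a′ i j r d A a′i a′j I′-diff d-gen =
      count-preimage tupleGroup pairGroup {T = T} {Q = λ st → J∖0 (proj₁ st) × J∖0 (proj₂ st)}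
        (λ b → ⟨ a , b ⟩ , ⟨ a′ , b ⟩) _≋?_
        (λ { (s , t) (s′ , t′) → (s ≟ s′) ×-dec (t ≟ t′) })
        (λ b≋c Ib k → I-resp (b≋c k) (Ib k)) (λ Ib Ic k → I-+ (Ib k) (Ic k)) (λ Ib k → I-neg (Ib k))
        (λ b≋c → symp-cong {a} (λ _ → refl) b≋c , symp-cong {a′} (λ _ → refl) b≋c)
        (λ b c → symp-⊕ʳ a b c , symp-⊕ʳ a′ b c)
        (λ b Ib → symp-I a b Ib , I′-diff b Ib)
        surjective
        (λ { (s≈ , t≈) (Js , Jt) → J∖0-resp s≈ Js , J∖0-resp t≈ Jt })
        -- Every pair of nonzero elements of `J` lies in the image, as t - rs stays in `J`; hence
        -- the factor (q - 1)².
        (λ { (s , t) ((Js , _) , (Jt , _)) → J⊆I Js , J⊆I′ (J-+ Jt (J-neg (J-* r Js))) })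
        (count-AllIn count-I) count-T
        (count-× isEquivalence isEquivalence J∖0-resp (count-J∖0 quotient) (count-J∖0 quotient))
      where
      T : Carrier × Carrier → Set
      T (s , t) = I s × I′ (t - r * s)
      count-T : HasClassCount (Pointwise _≈_ _≈_) T (t ℕ.* t′)
      -- The shear (s, y) ↦ (s, y + rs) identifies the product of `I` and `I′` with `T`.
      count-T = count-map {_≈_ = Pointwise _≈_ _≈_} {_~_ = Pointwise _≈_ _≈_}
        (λ { (s , y) _ → s , y + r * s })
        (λ { (s , y) (Is , I′y) → Is , proj₁ I′-ideal (sym (//-rightDividesʳ (r * s) y)) I′y })
        (λ { (s , y) _ (s′ , y′) _ (s≈ , t≈) → s≈ , ∙-cancelʳ (r * s) y y′
               (trans t≈ (+-congˡ (*-congˡ (sym s≈)))) })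
        (λ { (s , t) (Is , I′y) → (s , t - r * s) , (Is , I′y) ,
             λ { (s′ , y′) _ (s≈ , y≈) → s≈ , trans (+-cong y≈ (*-congˡ s≈)) (x-y+y≈x t (r * s)) } })
        (count-× isEquivalence isEquivalence I-resp count-I count-I′)
      surjective : ∀ st → T st → ∃ λ b → AllIn I b × Pointwise _≈_ _≈_ (⟨ a , b ⟩ , ⟨ a′ , b ⟩) st
      surjective (s , t) (Is , I′y) with x , Ix , dx≈ ← d-gen (t - r * s) I′y =
        dual j x ⊕ dual i y ,
        (λ k → I-+ (dual-ideal I-ideal j Ix k) (dual-ideal I-ideal i Iy k)) ,
        first , (begin
          ⟨ a′ , dual j x ⊕ dual i y ⟩              ≈⟨ symp-⊕ʳ a′ (dual j x) (dual i y) ⟩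
          ⟨ a′ , dual j x ⟩ + ⟨ a′ , dual i y ⟩     ≈⟨ +-cong (symp-dual a′ j x) (symp-dual a′ i y) ⟩
          a′ j * x + a′ i * y                       ≈⟨ +-cong (trans (*-congʳ a′j) (distribʳ x _ d)) (*-congʳ a′i) ⟩
          (r * a j * x + d * x) + r * a i * y       ≈⟨ CommutativeSemigroupₚ.xy∙z≈xz∙y +-commutativeSemigroup _ _ _ ⟩
          (r * a j * x + r * a i * y) + d * x       ≈⟨ +-congʳ (+-cong (*-assoc r _ x) (*-assoc r _ y)) ⟩
          (r * (a j * x) + r * (a i * y)) + d * x   ≈⟨ +-congʳ (distribˡ r _ _) ⟨
          r * (a j * x + a i * y) + d * x           ≈⟨ +-cong (*-congˡ solve-s) dx≈ ⟩
          r * s + (t - r * s)                       ≈⟨ +-comm _ _ ⟩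
          (t - r * s) + r * s                       ≈⟨ x-y+y≈x t (r * s) ⟩
          t                                         ∎)
        where
        -- Solves `a j * x + a i * y ≈ s`. Changing `y` leaves t - rs alone, because
        -- `a′ i ≈ r * a i`.
        y : Carrier
        y = proj₁ A * (s - a j * x)
        Iy : I y
        Iy = I-* _ (I-+ Is (I-neg (I-* _ Ix)))
        solve-s : a j * x + a i * y ≈ s
        solve-s = trans (+-congˡ (*-inverse A _)) (trans (+-comm _ _) (x-y+y≈x s (a j * x)))
        first : ⟨ a , dual j x ⊕ dual i y ⟩ ≈ s
        first = trans (symp-⊕ʳ a (dual j x) (dual i y)) (trans (+-cong (symp-dual a j x) (symp-dual a i y)) solve-s)

  -- Sizes of vertex sets in the graph

  count-order : ∃ λ c → c ℕ.* (q ℕ.* q ∸ q) ≡ (q ℕ.* q) ^ (e ℕ.+ e) ∸ q ^ (e ℕ.+ e) × HasClassCount _~_ (λ _ → ⊤) c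
  count-order = count-vertices (λ _ → yes tt) (λ _ _ → tt) (λ _ _ → tt)
    (count-cong {_~_ = _≋_} (λ _ Ia → Ia , tt) (λ _ → proj₁) (count-AllIn (count-K quotient)))
    (count-cong {_~_ = _≋_} (λ _ Ia → Ia , tt) (λ _ → proj₁) count-AllJ)

  -- Sort the tuples by the residue of the scalar relating them to `b`. There are q - 1 nonzero
  -- residues `l`, and each contributes the coset of `l ⊙ b` modulo tuples over `J`.
  count-~ᴶ-class : ∀ y → ∃ λ c → c ℕ.* (q ℕ.* q ∸ q) ≡ (q ∸ 1) ℕ.* q ^ (e ℕ.+ e) × HasClassCount _~_ (_~ᴶ y) c
  count-~ᴶ-class y@(b , i , B) = count-classes {P = Near}
    (λ a≋a′ → λ { (l , L , r) → l , L , λ k → ≈ᴶ.trans (≈⇒≈ᴶ (sym (a≋a′ k))) (r k) })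
    (λ { {m} M (l , L , r) → m * l , unit-* M L , λ k → ≈ᴶ.trans (≈ᴶ-*ˡ m (r k)) (≈⇒≈ᴶ (sym (*-assoc m l (b k)))) })
    (count-cong {_~_ = _≋_}
      (λ { a Na@(l , L , r) → Na , unit⇒¬AllJ (i , ≈ᴶ-unit (≈ᴶ.sym (r i)) (unit-* L B)) }) (λ _ → proj₁)
      (count-fibres {_≈_ = _≋_} (λ a → proj₁ B * a i) ≈ᴶ-isEquivalence (λ a≋a′ → ≈⇒≈ᴶ (*-congˡ (a≋a′ i)))
        (λ a Na → unit∉J (proj₁ (ratio-scalesᴶ a b i B Na))) (count-∉J/J quotient) fibre))
    where
    Near : Tuple K e → Set
    Near a = ∃ λ l → IsUnit K l × (∀ k → a k ≈ᴶ (l * b k))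
    fibre : ∀ l → ¬ J l → HasClassCount _≋_ (λ a → Near a × (proj₁ B * a i) ≈ᴶ l) (q ^ (e ℕ.+ e))
    fibre l ¬Jl = count-map {_≈_ = _≋_} {_~_ = _≋_} (λ c _ → c ⊕ (l ⊙ b))
      (λ c Jc → let near = λ k → J-resp (sym (//-rightDividesʳ (l * b k) (c k))) (Jc k) in
        (l , ∉J⇒unit ¬Jl , near) ,
        ≈ᴶ.trans (≈ᴶ-*ˡ (proj₁ B) (near i)) (≈⇒≈ᴶ (trans (*-congˡ (*-comm l (b i))) (inverse-* B l))))
      (λ c _ d _ r k → ∙-cancelʳ (l * b k) (c k) (d k) (r k))
      (λ { a (Na , l₀≈l) → (λ k → a k - l * b k) ,
           (λ k → ≈ᴶ.trans (proj₂ (ratio-scalesᴶ a b i B Na) k) (≈ᴶ-*ʳ (b k) l₀≈l)) ,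
           λ c _ r k → trans (+-congʳ (r k)) (x-y+y≈x (a k) (l * b k)) })
      count-AllJ

  J∖0-symp-resp : ∀ a b c → b ≋ c → J∖0 ⟨ a , b ⟩ → J∖0 ⟨ a , c ⟩
  J∖0-symp-resp a b c b≋c = J∖0-resp (symp-cong {a} {a} {b} {c} (λ _ → refl) b≋c)

  J∖0-symp-⊙ : ∀ a l b → IsUnit K l → J∖0 ⟨ a , b ⟩ → J∖0 ⟨ a , l ⊙ b ⟩
  J∖0-symp-⊙ a l b L j = J∖0-resp (sym (symp-⊙ʳ l a b)) (J∖0-* L j)

  count-neighbours : ∀ x → ∃ λ k₁ → ∃ λ k₂ → ∃ λ c →
    q ℕ.* q ℕ.* k₁ ≡ (q ℕ.* q) ^ (e ℕ.+ e) × q ℕ.* k₂ ≡ q ^ (e ℕ.+ e) ×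
    c ℕ.* (q ℕ.* q ∸ q) ≡ (q ∸ 1) ℕ.* k₁ ∸ (q ∸ 1) ℕ.* k₂ × HasClassCount _~_ (YAdj K J e x) c
  count-neighbours (a , i , A) =
    proj₁ inK , proj₁ inJ , proj₁ classes , proj₁ (proj₂ inK) , proj₁ (proj₂ inJ) , proj₂ classes
    where
    inK : ∃ λ k → q ℕ.* q ℕ.* k ≡ (q ℕ.* q) ^ (e ℕ.+ e) ×
          HasClassCount _≋_ (λ b → AllIn (WholeRing K) b × J∖0 ⟨ a , b ⟩) ((q ∸ 1) ℕ.* k)
    inK = count-J∖0-symp whole-ideal (λ _ → tt) (count-K quotient) a i A
    inJ : ∃ λ k → q ℕ.* k ≡ q ^ (e ℕ.+ e) ×
          HasClassCount _≋_ (λ b → AllIn J b × J∖0 ⟨ a , b ⟩) ((q ∸ 1) ℕ.* k)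
    inJ = count-J∖0-symp J-ideal id (count-J quotient) a i A
    classes : ∃ λ c → c ℕ.* (q ℕ.* q ∸ q) ≡ (q ∸ 1) ℕ.* proj₁ inK ∸ (q ∸ 1) ℕ.* proj₁ inJ ×
              HasClassCount _~_ (λ z → J∖0 ⟨ a , proj₁ z ⟩) c
    classes = count-vertices {P = λ b → J∖0 ⟨ a , b ⟩} (λ b → J∖0? ⟨ a , b ⟩)
      (λ {b} {c} → J∖0-symp-resp a b c) (λ {l} {b} → J∖0-symp-⊙ a l b) (proj₂ (proj₂ inK)) (proj₂ (proj₂ inJ))

  Common : Tuple K e → Tuple K e → Tuple K e → Set
  Common a a′ b = J∖0 ⟨ a , b ⟩ × J∖0 ⟨ a′ , b ⟩

  count-common : ∀ a a′ {n₁ n₂} → HasClassCount _≋_ (λ b → AllIn (WholeRing K) b × Common a a′ b) n₁ →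
    HasClassCount _≋_ (λ b → AllIn J b × Common a a′ b) n₂ →
    ∃ λ c → c ℕ.* (q ℕ.* q ∸ q) ≡ n₁ ∸ n₂ × HasClassCount _~_ (Common a a′ ∘ proj₁) c
  count-common a a′ = count-vertices (λ b → J∖0? ⟨ a , b ⟩ ×-dec J∖0? ⟨ a′ , b ⟩)
    (λ { {b} {c} b≋c (j , j′) → J∖0-symp-resp a b c b≋c j , J∖0-symp-resp a′ b c b≋c j′ })
    (λ { {l} {b} L (j , j′) → J∖0-symp-⊙ a l b L j , J∖0-symp-⊙ a′ l b L j′ })

  x≈z+[x-z] : ∀ x z → x ≈ z + (x - z)
  x≈z+[x-z] x z = sym (trans (+-comm z (x - z)) (x-y+y≈x x z))

  -- Modulo `J`, `a′` is a unit multiple of `a`. The difference `a″` has all entries in `J`, and one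
  -- is nonzero since the vertices differ; that entry generates `J`, so t - rs takes every value in
  -- `J` and no other. Over `J` the forms are proportional, hence a single factor q - 1 with `k₂`.
  count-common-same : ∀ x y → ¬ x ~ y → x ~ᴶ y → ∃ λ k₁ → ∃ λ k₂ → ∃ λ c →
    q ℕ.* q ℕ.* q ℕ.* k₁ ≡ (q ℕ.* q) ^ (e ℕ.+ e) × q ℕ.* k₂ ≡ q ^ (e ℕ.+ e) ×
    c ℕ.* (q ℕ.* q ∸ q) ≡ (q ∸ 1) ℕ.* (q ∸ 1) ℕ.* k₁ ∸ (q ∸ 1) ℕ.* k₂ ×
    HasClassCount _~_ (λ z → YAdj K J e x z × YAdj K J e y z) c
  count-common-same x@(a , i , A) y@(a′ , _) x≁y x~ᴶy =
    proj₁ inK , proj₁ inJ , proj₁ classes , proj₁ (proj₂ inK) , proj₁ (proj₂ inJ) , proj₂ classes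
    where
    r : Carrier
    r = proj₁ A * a′ i
    scales : IsUnit K r × (∀ k → a′ k ≈ᴶ (r * a k))
    scales = ratio-scalesᴶ a′ a i A (~ᴶ.sym {x} {y} x~ᴶy)
    a″ : Tuple K e
    a″ k = a′ k - r * a k
    a″-nonzero : ∃ λ j → ¬ a″ j ≈ 0#
    a″-nonzero with Finₚ.any? (λ j → ¬? (a″ j ≟ 0#))
    ... | yes found = found
    ... | no  none  = ⊥-elim (x≁y (~.sym {y} {x} (r , proj₁ scales , λ k → x∙y⁻¹≈ε⇒x≈y _ _
                        (decidable-stable (a″ k ≟ 0#) λ a″k≉0 → none (k , a″k≉0)))))
    proportional : ∀ b → AllIn J b → ⟨ a′ , b ⟩ ≈ r * ⟨ a , b ⟩
    proportional b Jb = x∙y⁻¹≈ε⇒x≈y _ _ (trans (symp-diff r a a′ b)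
      (symp-ideal zero-ideal a″ b (λ k l → J²≈0 (proj₂ scales k) (Jb l))))
    j : Fin (e ℕ.+ e)
    j = proj₁ a″-nonzero
    inK : ∃ λ k → q ℕ.* q ℕ.* q ℕ.* k ≡ (q ℕ.* q) ^ (e ℕ.+ e) ×
          HasClassCount _≋_ (λ b → AllIn (WholeRing K) b × Common a a′ b) ((q ∸ 1) ℕ.* (q ∸ 1) ℕ.* k)
    inK = count-J∖0-symp₂ whole-ideal (λ _ → tt) (count-K quotient) J-ideal id (count-J quotient)
      a a′ i j r (a″ j) A (trans (sym (*-inverse A (a′ i))) (*-comm (a i) r)) (x≈z+[x-z] (a′ j) (r * a j))
      (λ b _ → J-resp (sym (symp-diff r a a′ b)) (symp-ideal J-ideal a″ b (λ k l → J-*ʳ (b l) (proj₂ scales k))))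
      (λ y Jy → let (x , y≈) = J-generated (proj₂ scales j) (proj₂ a″-nonzero) y Jy in
                x , tt , trans (*-comm (a″ j) x) (sym y≈))
    inJ : ∃ λ k → q ℕ.* k ≡ q ^ (e ℕ.+ e) ×
          HasClassCount _≋_ (λ b → AllIn J b × J∖0 ⟨ a , b ⟩) ((q ∸ 1) ℕ.* k)
    inJ = count-J∖0-symp J-ideal id (count-J quotient) a i A
    classes : ∃ λ c → c ℕ.* (q ℕ.* q ∸ q) ≡ (q ∸ 1) ℕ.* (q ∸ 1) ℕ.* proj₁ inK ∸ (q ∸ 1) ℕ.* proj₁ inJ ×
              HasClassCount _~_ (Common a a′ ∘ proj₁) c
    classes = count-common a a′ (proj₂ (proj₂ inK)) (count-cong {_~_ = _≋_}
      (λ { b (Jb , j) → Jb , j , J∖0-resp (sym (proportional b Jb)) (J∖0-* (proj₁ scales) j) })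
      (λ { b (Jb , j , _) → Jb , j }) (proj₂ (proj₂ inJ)))

  -- Now `a″` has a unit entry, so t - rs can be prescribed freely, over the whole ring and over `J`
  -- alike.
  count-common-diff : ∀ x y → ¬ x ~ᴶ y → ∃ λ k₁ → ∃ λ k₂ → ∃ λ c →
    q ℕ.* q ℕ.* (q ℕ.* q) ℕ.* k₁ ≡ (q ℕ.* q) ^ (e ℕ.+ e) × q ℕ.* q ℕ.* k₂ ≡ q ^ (e ℕ.+ e) ×
    c ℕ.* (q ℕ.* q ∸ q) ≡ (q ∸ 1) ℕ.* (q ∸ 1) ℕ.* k₁ ∸ (q ∸ 1) ℕ.* (q ∸ 1) ℕ.* k₂ ×
    HasClassCount _~_ (λ z → YAdj K J e x z × YAdj K J e y z) c
  count-common-diff x@(a , i , A) y@(a′ , i′ , A′) x≁y =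
    proj₁ inK , proj₁ inJ , proj₁ classes , proj₁ (proj₂ inK) , proj₁ (proj₂ inJ) , proj₂ classes
    where
    r : Carrier
    r = proj₁ A * a′ i
    a″ : Tuple K e
    a″ k = a′ k - r * a k
    a″-unit : ∃ λ j → IsUnit K (a″ j)
    a″-unit = ¬AllJ⇒unit λ Ja″ → x≁y (~ᴶ.sym {y} {x}
      -- If `r` were in `J`, then `a′`, congruent to `r ⊙ a`, would have no unit entry.
      (r , ∉J⇒unit (λ Jr → unit∉J A′ (J-resp-≈ᴶ (≈ᴶ.sym (Ja″ i′)) (J-*ʳ (a i′) Jr))) , Ja″))
    a′i : a′ i ≈ r * a i
    a′i = trans (sym (*-inverse A (a′ i))) (*-comm (a i) r)
    j : Fin (e ℕ.+ e)
    j = proj₁ a″-unit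
    D : IsUnit K (a″ j)
    D = proj₂ a″-unit
    inK : ∃ λ k → q ℕ.* q ℕ.* (q ℕ.* q) ℕ.* k ≡ (q ℕ.* q) ^ (e ℕ.+ e) ×
          HasClassCount _≋_ (λ b → AllIn (WholeRing K) b × Common a a′ b) ((q ∸ 1) ℕ.* (q ∸ 1) ℕ.* k)
    inK = count-J∖0-symp₂ whole-ideal (λ _ → tt) (count-K quotient) whole-ideal (λ _ → tt) (count-K quotient)
      a a′ i j r (a″ j) A a′i (x≈z+[x-z] (a′ j) (r * a j))
      (λ _ _ → tt) (λ y _ → proj₁ D * y , tt , *-inverse D y)
    inJ : ∃ λ k → q ℕ.* q ℕ.* k ≡ q ^ (e ℕ.+ e) ×
          HasClassCount _≋_ (λ b → AllIn J b × Common a a′ b) ((q ∸ 1) ℕ.* (q ∸ 1) ℕ.* k)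
    inJ = count-J∖0-symp₂ J-ideal id (count-J quotient) J-ideal id (count-J quotient)
      a a′ i j r (a″ j) A a′i (x≈z+[x-z] (a′ j) (r * a j))
      (λ b Jb → J-resp (sym (symp-diff r a a′ b)) (symp-ideal J-ideal a″ b (λ k l → J-* (a″ k) (Jb l))))
      (λ y Jy → proj₁ D * y , J-* (proj₁ D) Jy , *-inverse D y)
    classes : ∃ λ c → c ℕ.* (q ℕ.* q ∸ q) ≡ (q ∸ 1) ℕ.* (q ∸ 1) ℕ.* proj₁ inK ∸ (q ∸ 1) ℕ.* (q ∸ 1) ℕ.* proj₁ inJ ×
              HasClassCount _~_ (Common a a′ ∘ proj₁) c
    classes = count-common a a′ (proj₂ (proj₂ inK)) (proj₂ (proj₂ inJ))

  -- The points of the projective space are not counted on their own: their number is the solution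
  -- of `m * n ≡ v`.
  count-parts : ∀ {v n} → HasClassCount _~_ (λ _ → ⊤) v → (∀ y → HasClassCount _~_ (_~ᴶ y) n) →
                ∃ λ m → m ℕ.* n ≡ v × HasClassCount _~ᴶ_ (λ _ → ⊤) m
  count-parts {v} {n} Cv Cn = proj₁ cover ,
    count-unique ~-isEquivalence
      (count-fibres {_≈_ = _~_} id ~ᴶ-isEquivalence (λ {x} {y} → ~⇒~ᴶ {x} {y}) (λ _ _ → tt) Cm
        λ y _ → count-cong {_~_ = _~_} (λ _ r → tt , r) (λ _ → proj₂) (Cn y)) Cv ,
    Cm
    where
    cover : ∃ (HasClassCount _~ᴶ_ (λ x → ⊤ × ∃ λ j → proj₁ Cv j ~ᴶ x))
    cover = count-covered ~ᴶ-isEquivalence _~ᴶ?_ (λ _ → yes tt) (λ _ _ → tt) (proj₁ Cv)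
    Cm : HasClassCount _~ᴶ_ (λ _ → ⊤) (proj₁ cover)
    Cm = count-cong {_~_ = _~ᴶ_} (λ _ _ → tt)
      (λ x _ → let (j , r) = proj₂ (proj₂ (proj₂ Cv)) x tt in tt , j , ~⇒~ᴶ {proj₁ Cv j} {x} r)
      (proj₂ cover)

  adj-resp : ∀ x x′ y y′ → x ~ x′ → y ~ y′ → YAdj K J e x y → YAdj K J e x′ y′
  adj-resp x@(a , _) x′@(a′ , _) y@(b , _) y′@(b′ , _) x~x′ y~y′ adj
    with l , L , r ← ~.sym {x} {x′} x~x′ | m , M , s ← ~.sym {y} {y′} y~y′ =
    J∖0-resp (sym (begin
      ⟨ a′ , b′ ⟩          ≈⟨ symp-cong {a′} {l ⊙ a} {b′} {m ⊙ b} r s ⟩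
      ⟨ l ⊙ a , m ⊙ b ⟩    ≈⟨ symp-⊙ˡ l a (m ⊙ b) ⟩
      l * ⟨ a , m ⊙ b ⟩    ≈⟨ *-congˡ (symp-⊙ʳ m a b) ⟩
      l * (m * ⟨ a , b ⟩)  ∎)) (J∖0-* L (J∖0-* M adj))

  adj-sym : ∀ x y → YAdj K J e x y → YAdj K J e y x
  adj-sym (a , _) (b , _) (Jab , ab≉0) =
    J-resp (sym (symp-antisym a b)) (J-neg Jab) ,
    λ ba≈0 → ab≉0 (trans (symp-antisym b a) (trans (-‿cong ba≈0) ε⁻¹≈ε))

-- The parameters

module Arithmetic where

  open import Data.Nat using (_+_; _*_)
  open ℕₚ
  open ≡ using (sym; trans)

  div-unique : ∀ c {x} d .{{_ : NonZero d}} → c * d ≡ x → x div d ≡ c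
  div-unique c (suc d) ≡.refl = m*n/n≡m c (suc d)

  ^-distribʳ-* : ∀ n x y → (x * y) ^ n ≡ x ^ n * y ^ n
  ^-distribʳ-* zero    x y = ≡.refl
  ^-distribʳ-* (suc n) x y = trans (cong (x * y *_) (^-distribʳ-* n x y)) ([m*n]*[o*p]≡[m*o]*[n*p] x y (x ^ n) (y ^ n))

  module Parameters (e₀ r₀ : ℕ) where
    private
      e r q p u : ℕ
      e = suc (suc e₀)
      r = suc r₀
      q = suc r
      -- This is q^(2e-3), the least power of q in the parameters. Every power involved becomes a
      -- monomial in `q` and `p`, within reach of the ring solver.
      p = q ^ (2 * e₀ + 1)
      u = q * q ∸ q

      q^ : ∀ k {n} → n ≡ k + (2 * e₀ + 1) → q ^ n ≡ q ^ k * p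
      q^ k ≡.refl = ^-distribˡ-+-* q k (2 * e₀ + 1)

      q^² : ∀ k {n} → n ≡ k + ((2 * e₀ + 1) + (2 * e₀ + 1)) → q ^ n ≡ q ^ k * (p * p)
      q^² k ≡.refl = trans (^-distribˡ-+-* q k _) (cong (q ^ k *_) (^-distribˡ-+-* q (2 * e₀ + 1) (2 * e₀ + 1)))

      -- The leading numeral lets subtractions such as `4 * e ∸ 3` reduce by computation.
      4e : 4 * e ≡ 6 + ((2 * e₀ + 1) + (2 * e₀ + 1))
      4e = lemma e₀
        where
        lemma : ∀ x → 4 * (2 + x) ≡ 6 + ((2 * x + 1) + (2 * x + 1))
        lemma = solve-∀

      2e : 2 * e ≡ 3 + (2 * e₀ + 1)
      2e = lemma e₀
        where
        lemma : ∀ x → 2 * (2 + x) ≡ 3 + (2 * x + 1)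
        lemma = solve-∀

      J-tuples : q ^ (e + e) ≡ q * (q * (q * p))
      J-tuples = trans (q^ 3 (trans (cong (e +_) (sym (+-identityʳ e))) 2e)) (lemma q p)
        where
        lemma : ∀ q p → q * (q * (q * 1)) * p ≡ q * (q * (q * p))
        lemma = solve-∀

      K-tuples : (q * q) ^ (e + e) ≡ q * (q * (q * p)) * (q * (q * (q * p)))
      K-tuples = trans (^-distribʳ-* (e + e) q q) (cong₂ _*_ J-tuples J-tuples)

      units : u ≡ r * q
      units = m+n∸m≡n q (r * q)

      instance
        p-nonZero : NonZero p
        p-nonZero = m^n≢0 q (2 * e₀ + 1)

      div-units : ∀ {c X Y} → Y ≡ X * (r * q) → c * u ≡ Y → c ≡ X
      div-units {c} {X} Y≡ cu≡Y = *-cancelʳ-≡ c X (r * q) (trans (cong (c *_) (sym units)) (trans cu≡Y Y≡))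

    nY-count : ∀ c → c * u ≡ r * q ^ (e + e) → c ≡ nY q e
    nY-count c h = trans (div-units (trans (cong (r *_) J-tuples) (lemma r q p)) h)
      (sym (q^ 2 (cong (_∸ 1) 2e)))
      where
      lemma : ∀ r q p → r * (q * (q * (q * p))) ≡ (q * (q * 1) * p) * (r * q)
      lemma = solve-∀

    private
      nY≡ : nY q e ≡ q * q * p
      nY≡ = trans (q^ 2 (cong (_∸ 1) 2e)) (lemma q p)
        where
        lemma : ∀ q p → (q * (q * 1) * p) ≡ q * q * p
        lemma = solve-∀

      points : ∀ c → c * u ≡ (q * q) ^ (e + e) ∸ q ^ (e + e) → c * r ≡ nY q e * (q ^ (2 * e) ∸ 1)
      points c h = *-cancelʳ-≡ _ _ q (begin
        c * r * q                    ≡⟨ *-assoc c r q ⟩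
        c * (r * q)                  ≡⟨ cong (c *_) units ⟨
        c * u                        ≡⟨ h ⟩
        (q * q) ^ (e + e) ∸ q ^ (e + e) ≡⟨ cong₂ _∸_ K-tuples J-tuples ⟩
        Q * Q ∸ Q                    ≡⟨ cong (Q * Q ∸_) (*-identityʳ Q) ⟨
        Q * Q ∸ Q * 1                ≡⟨ *-distribˡ-∸ Q Q 1 ⟨
        Q * (Q ∸ 1)                  ≡⟨ lemma q p (Q ∸ 1) ⟩
        q * q * p * (Q ∸ 1) * q      ≡⟨ cong₂ (λ n Q → n * (Q ∸ 1) * q) nY≡
                                          (trans (cong (λ n → q ^ (e + n)) (+-identityʳ e)) J-tuples) ⟨
        nY q e * (q ^ (2 * e) ∸ 1) * q ∎)
        where
        open ≡.≡-Reasoning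
        Q = q * (q * (q * p))
        lemma : ∀ q p x → q * (q * (q * p)) * x ≡ q * q * p * x * q
        lemma = solve-∀

    vY-count : ∀ c → c * u ≡ (q * q) ^ (e + e) ∸ q ^ (e + e) → c ≡ vY q e
    vY-count c h = sym (div-unique c r (points c h))

    mY-count : ∀ m → m * nY q e * u ≡ (q * q) ^ (e + e) ∸ q ^ (e + e) → m ≡ mY q e
    mY-count m h = sym (div-unique m r (*-cancelˡ-≡ _ _ (nY q e) {{m^n≢0 q (2 * e ∸ 1)}}
      (trans (lemma (nY q e) m r) (points (m * nY q e) h))))
      where
      lemma : ∀ n m r → n * (m * r) ≡ m * n * r
      lemma = solve-∀

    -- Here `k₁` is q^(4e-2) and `k₂` is q^(2e-1).
    kY-count : ∀ k₁ k₂ c → q * q * k₁ ≡ (q * q) ^ (e + e) → q * k₂ ≡ q ^ (e + e) →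
               c * u ≡ r * k₁ ∸ r * k₂ → c ≡ kY q e
    kY-count k₁ k₂ c h₁ h₂ h = trans (div-units {X = q ^ 3 * (p * p) ∸ q ^ 1 * p} (begin
        r * k₁ ∸ r * k₂
          ≡⟨ cong₂ (λ x y → r * x ∸ r * y)
               (*-cancelˡ-≡ k₁ (q * q * (q * q) * p * p) (q * q) (trans h₁ (trans K-tuples (lemma₁ q p))))
               (*-cancelˡ-≡ k₂ (q * q * p) q (trans h₂ (trans J-tuples (lemma₂ q p)))) ⟩
        r * (q * q * (q * q) * p * p) ∸ r * (q * q * p)
          ≡⟨ cong₂ _∸_ (lemma₃ r q p) (lemma₄ r q p) ⟩
        q ^ 3 * (p * p) * (r * q) ∸ q ^ 1 * p * (r * q)
          ≡⟨ *-distribʳ-∸ (r * q) (q ^ 3 * (p * p)) (q ^ 1 * p) ⟨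
        (q ^ 3 * (p * p) ∸ q ^ 1 * p) * (r * q) ∎) h)
      (sym (cong₂ _∸_ (q^² 3 (cong (_∸ 3) 4e)) (q^ 1 (cong (_∸ 2) 2e))))
      where
      open ≡.≡-Reasoning
      lemma₁ : ∀ q p → q * (q * (q * p)) * (q * (q * (q * p))) ≡ q * q * (q * q * (q * q) * p * p)
      lemma₁ = solve-∀
      lemma₂ : ∀ q p → q * (q * (q * p)) ≡ q * (q * q * p)
      lemma₂ = solve-∀
      lemma₃ : ∀ r q p → r * (q * q * (q * q) * p * p) ≡ q * (q * (q * 1)) * (p * p) * (r * q)
      lemma₃ = solve-∀
      lemma₄ : ∀ r q p → r * (q * q * p) ≡ q * 1 * p * (r * q)
      lemma₄ = solve-∀

    -- The image has index one power of q lower than that of a full pair, so `k₁` is q^(4e-3); `k₂`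
    -- is still q^(2e-1).
    λ₁Y-count : ∀ k₁ k₂ c → q * q * q * k₁ ≡ (q * q) ^ (e + e) → q * k₂ ≡ q ^ (e + e) →
                c * u ≡ r * r * k₁ ∸ r * k₂ → c ≡ λ₁Y q e
    λ₁Y-count k₁ k₂ c h₁ h₂ h = trans (div-units {X = r * (q * q * p * p) ∸ q ^ 1 * p} (begin
        r * r * k₁ ∸ r * k₂
          ≡⟨ cong₂ (λ x y → r * r * x ∸ r * y)
               (*-cancelˡ-≡ k₁ (q * q * q * p * p) (q * q * q) (trans h₁ (trans K-tuples (lemma₁ q p))))
               (*-cancelˡ-≡ k₂ (q * q * p) q (trans h₂ (trans J-tuples (lemma₂ q p)))) ⟩
        r * r * (q * q * q * p * p) ∸ r * (q * q * p)
          ≡⟨ cong₂ _∸_ (lemma₃ r q p) (lemma₄ r q p) ⟩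
        r * (q * q * p * p) * (r * q) ∸ q ^ 1 * p * (r * q)
          ≡⟨ *-distribʳ-∸ (r * q) (r * (q * q * p * p)) (q ^ 1 * p) ⟨
        (r * (q * q * p * p) ∸ q ^ 1 * p) * (r * q) ∎) h)
      (sym (cong₂ _∸_ (begin
        q ^ (4 * e ∸ 3) ∸ q ^ (4 * e ∸ 4)
          ≡⟨ cong₂ _∸_ (q^² 3 (cong (_∸ 3) 4e)) (q^² 2 (cong (_∸ 4) 4e)) ⟩
        q ^ 3 * (p * p) ∸ q ^ 2 * (p * p)
          -- Writing q as 1 + r exposes the subtracted term as a summand, which then cancels
          -- exactly.
          ≡⟨ cong₂ _∸_ (lemma₅ r p) (lemma₆ q p) ⟩
        q * q * p * p + r * (q * q * p * p) ∸ q * q * p * p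
          ≡⟨ m+n∸m≡n (q * q * p * p) _ ⟩
        r * (q * q * p * p) ∎)
        (q^ 1 (cong (_∸ 2) 2e))))
      where
      open ≡.≡-Reasoning
      lemma₁ : ∀ q p → q * (q * (q * p)) * (q * (q * (q * p))) ≡ q * q * q * (q * q * q * p * p)
      lemma₁ = solve-∀
      lemma₂ : ∀ q p → q * (q * (q * p)) ≡ q * (q * q * p)
      lemma₂ = solve-∀
      lemma₃ : ∀ r q p → r * r * (q * q * q * p * p) ≡ r * (q * q * p * p) * (r * q)
      lemma₃ = solve-∀
      lemma₄ : ∀ r q p → r * (q * q * p) ≡ q * 1 * p * (r * q)
      lemma₄ = solve-∀
      lemma₅ : ∀ r p → (1 + r) * ((1 + r) * ((1 + r) * 1)) * (p * p)
                     ≡ (1 + r) * (1 + r) * p * p + r * ((1 + r) * (1 + r) * p * p)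
      lemma₅ = solve-∀
      lemma₆ : ∀ q p → q * (q * 1) * (p * p) ≡ q * q * p * p
      lemma₆ = solve-∀

    -- Here `k₁` is q^(4e-4) and `k₂` is q^(2e-2). The stated parameter subtracts q^(2e-2) before
    -- adding q^(2e-3) back, so `p≤` must show that nothing is truncated in between.
    λ₂Y-count : ∀ k₁ k₂ c → q * q * (q * q) * k₁ ≡ (q * q) ^ (e + e) → q * q * k₂ ≡ q ^ (e + e) →
                c * u ≡ r * r * k₁ ∸ r * r * k₂ → c ≡ λ₂Y q e
    λ₂Y-count k₁ k₂ c h₁ h₂ h = trans (div-units {X = r * (q * p * p) ∸ r * p} (begin
        r * r * k₁ ∸ r * r * k₂
          ≡⟨ cong₂ (λ x y → r * r * x ∸ r * r * y)
               (*-cancelˡ-≡ k₁ (q * q * p * p) (q * q * (q * q)) (trans h₁ (trans K-tuples (lemma₁ q p))))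
               (*-cancelˡ-≡ k₂ (q * p) (q * q) (trans h₂ (trans J-tuples (lemma₂ q p)))) ⟩
        r * r * (q * q * p * p) ∸ r * r * (q * p)
          ≡⟨ cong₂ _∸_ (lemma₃ r q p) (lemma₄ r q p) ⟩
        r * (q * p * p) * (r * q) ∸ r * p * (r * q)
          ≡⟨ *-distribʳ-∸ (r * q) (r * (q * p * p)) (r * p) ⟨
        (r * (q * p * p) ∸ r * p) * (r * q) ∎) h)
      (sym (begin
        (q ^ (4 * e ∸ 4) ∸ q ^ (4 * e ∸ 5) ∸ q ^ (2 * e ∸ 2)) + q ^ (2 * e ∸ 3)
          ≡⟨ cong₂ _+_ (cong₂ _∸_ (cong₂ _∸_ (q^² 2 (cong (_∸ 4) 4e)) (q^² 1 (cong (_∸ 5) 4e)))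
                       (q^ 1 (cong (_∸ 2) 2e))) (cong (q ^_) (cong (_∸ 3) 2e)) ⟩
        (q ^ 2 * (p * p) ∸ q ^ 1 * (p * p) ∸ q ^ 1 * p) + p
          ≡⟨ cong (_+ p) (cong₂ _∸_ (cong₂ _∸_ (lemma₅ r p) (lemma₆ q p)) (lemma₇ r p)) ⟩
        (q * p * p + r * (q * p * p) ∸ q * p * p ∸ (r * p + p)) + p
          ≡⟨ cong (λ x → (x ∸ (r * p + p)) + p) (m+n∸m≡n (q * p * p) _) ⟩
        (r * (q * p * p) ∸ (r * p + p)) + p
          ≡⟨ cong (_+ p) (∸-+-assoc (r * (q * p * p)) (r * p) p) ⟨
        (r * (q * p * p) ∸ r * p ∸ p) + p
          ≡⟨ m∸n+n≡m p≤ ⟩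
        r * (q * p * p) ∸ r * p ∎))
      where
      open ≡.≡-Reasoning
      lemma₁ : ∀ q p → q * (q * (q * p)) * (q * (q * (q * p))) ≡ q * q * (q * q) * (q * q * p * p)
      lemma₁ = solve-∀
      lemma₂ : ∀ q p → q * (q * (q * p)) ≡ q * q * (q * p)
      lemma₂ = solve-∀
      lemma₃ : ∀ r q p → r * r * (q * q * p * p) ≡ r * (q * p * p) * (r * q)
      lemma₃ = solve-∀
      lemma₄ : ∀ r q p → r * r * (q * p) ≡ r * p * (r * q)
      lemma₄ = solve-∀
      lemma₅ : ∀ r p → (1 + r) * ((1 + r) * 1) * (p * p) ≡ (1 + r) * p * p + r * ((1 + r) * p * p)
      lemma₅ = solve-∀
      lemma₆ : ∀ q p → q * 1 * (p * p) ≡ q * p * p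
      lemma₆ = solve-∀
      lemma₇ : ∀ r p → (1 + r) * 1 * p ≡ r * p + p
      lemma₇ = solve-∀
      lemma₈ : ∀ r q p → q * p * (r * p) ≡ r * (q * p * p)
      lemma₈ = solve-∀
      p≤ : p ≤ r * (q * p * p) ∸ r * p
      -- By definition `p + r * p` is `q * p`, which is at most `q * p * (r * p)` as `r` and `p` are
      -- positive.
      p≤ = m+n≤o⇒m≤o∸n p (≤-trans (m≤m*n (q * p) (r * p) {{m*n≢0 r p}}) (≤-reflexive (lemma₈ r q p)))

-- Assembling the design

isDDG-Y : ∀ e₀ r₀ (K : CommutativeRing 0ℓ 0ℓ) → IsFiniteRing K →
  (J : CommutativeRing.Carrier K → Set) → HasExactlyThreeIdeals K J → QuotientHasSize K J (2 ℕ.+ r₀) →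
  let e = 2 ℕ.+ e₀ ; q = 2 ℕ.+ r₀ in
  IsDDG (YEquiv K e) (YAdj K J e) (vY q e) (kY q e) (λ₁Y q e) (λ₂Y q e) (mY q e) (nY q e)
isDDG-Y e₀ r₀ K finite J three quotient = record
  { ~-equiv    = ~-isEquivalence
  ; adj-resp   = λ {x} {x′} {y} {y′} → adj-resp x x′ y y′
  ; adj-sym    = λ {x} {y} → adj-sym x y
  ; adj-irrefl = λ { (a , _) (_ , aa≉0) → aa≉0 (symp-self a) }
  ; order      = C-order
  ; regular    = λ x → let (k₁ , k₂ , c , h₁ , h₂ , h , C) = count-neighbours x in
                   subst (HasClassCount _~_ (YAdj K J e x)) (kY-count k₁ k₂ c h₁ h₂ h) C
  ; part       = part
  ; part-resp  = λ {x} {y} x~y → ~ᴶ⇒part x y (~⇒~ᴶ {x} {y} x~y)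
  ; part-size  = λ i → count-cong {_~_ = _~_}
                   (λ x r → index-unique x i (~ᴶ.sym {x} {rep i} r))
                   (λ { x ≡.refl → ~ᴶ.sym {rep (part x)} {x} (rep-part x) })
                   (C-size (rep i))
  ; same-class = λ x y x≁y eq →
                   let (k₁ , k₂ , c , h₁ , h₂ , h , C) = count-common-same x y x≁y (part⇒~ᴶ x y eq) in
                   subst (HasClassCount _~_ (λ z → YAdj K J e x z × YAdj K J e y z)) (λ₁Y-count k₁ k₂ c h₁ h₂ h) C
  ; diff-class = λ x y ne →
                   let (k₁ , k₂ , c , h₁ , h₂ , h , C) = count-common-diff x y (λ x~y → ne (~ᴶ⇒part x y x~y)) in
                   subst (HasClassCount _~_ (λ z → YAdj K J e x z × YAdj K J e y z)) (λ₂Y-count k₁ k₂ c h₁ h₂ h) C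
  }
  where
  e q : ℕ
  e = 2 ℕ.+ e₀
  q = 2 ℕ.+ r₀
  open Graph K finite J three quotient e
  open Symplectic K e using (symp-self)
  open Arithmetic.Parameters e₀ r₀
  C-order : HasClassCount _~_ (λ _ → ⊤) (vY q e)
  C-order = let (c , h , C) = count-order in subst (HasClassCount _~_ (λ _ → ⊤)) (vY-count c h) C
  C-size : ∀ y → HasClassCount _~_ (_~ᴶ y) (nY q e)
  C-size y = let (c , h , C) = count-~ᴶ-class y in subst (HasClassCount _~_ (_~ᴶ y)) (nY-count c h) C
  C-parts : HasClassCount _~ᴶ_ (λ _ → ⊤) (mY q e)
  C-parts = let (c , h , C) = count-order ; (m , mn≡c , Cm) = count-parts C C-size in
    subst (HasClassCount _~ᴶ_ (λ _ → ⊤)) (mY-count m (≡.trans (cong (ℕ._* (q ℕ.* q ∸ q)) mn≡c) h)) Cm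
  rep : Fin (mY q e) → YVertex K e
  rep = proj₁ C-parts
  part : YVertex K e → Fin (mY q e)
  part x = proj₁ (proj₂ (proj₂ (proj₂ C-parts)) x tt)
  rep-part : ∀ x → rep (part x) ~ᴶ x
  rep-part x = proj₂ (proj₂ (proj₂ (proj₂ C-parts)) x tt)
  -- Representatives of distinct points are inequivalent, so `part x` is the only index whose
  -- representative lies in the class of `x`.
  index-unique : ∀ x i → rep i ~ᴶ x → part x ≡ i
  index-unique x i r = proj₁ (proj₂ (proj₂ C-parts)) (part x) i
    (~ᴶ.trans {rep (part x)} {x} {rep i} (rep-part x) (~ᴶ.sym {rep i} {x} r))
  ~ᴶ⇒part : ∀ x y → x ~ᴶ y → part x ≡ part y
  ~ᴶ⇒part x y x~y = index-unique x (part y)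
    (~ᴶ.trans {rep (part y)} {y} {x} (rep-part y) (~ᴶ.sym {x} {y} x~y))
  part⇒~ᴶ : ∀ x y → part x ≡ part y → x ~ᴶ y
  part⇒~ᴶ x y eq = ~ᴶ.trans {x} {rep (part x)} {y} (~ᴶ.sym {rep (part x)} {x} (rep-part x))
    (subst (λ i → rep i ~ᴶ y) (≡.sym eq) (rep-part y))

theorem1p2 : (e : ℕ) → 2 ≤ e →
    (K : CommutativeRing 0ℓ 0ℓ) → IsFiniteRing K →
    (J : CommutativeRing.Carrier K → Set) → HasExactlyThreeIdeals K J →
    (q : ℕ) → IsPrimePower q → QuotientHasSize K J q →
    IsDDG (YEquiv K e) (YAdj K J e)
    (vY q e) (kY q e) (λ₁Y q e) (λ₂Y q e) (mY q e) (nY q e)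
theorem1p2 (suc (suc e₀)) (s≤s (s≤s z≤n)) K finite J three q _ quotient
  -- Rewrites `q` as 2 + r₀, so that `q ∸ 1` and `div` compute.
  with s≤s (s≤s (z≤n {r₀})) ← Local.2≤q K finite J three quotient
  = isDDG-Y e₀ r₀ K finite J three quotient
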